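{- Let $m\ge 5$. Let $\Gamma$ be a graph with a vertex partition $\{C_1,\dots,C_m,D\}$, where the indices of the sets $C_i$ are read in $\mathbb{Z}/m\mathbb{Z}$, such that: (i) $|C_1|=\cdots=|C_m|=2$; write $C_i=\{v_{i1},v_{i2}\}$. (ii) For every vertex $v\in D$, the numbers of neighbours of $v$ in $C_1,\dots,C_m$ are all congruent modulo $2$. (iii) For all $i,j\in\mathbb{Z}/m\mathbb{Z}$ with $j\in\{i+1,\dots,i+\lfloor\frac{m}{2}\rfloor\}$, the edge set of the induced subgraph on $C_i\cup C_j$ is: - either $\{v_{i1}v_{j1},\,v_{i1}v_{j2}\}$ or $\{v_{i2}v_{j1},\,v_{i2}v_{j2}\}$, if $j=i+1$; - either $\{v_{i1}v_{j1},\,v_{i2}v_{j1}\}$ or $\{v_{i1}v_{j2},\,v_{i2}v_{j2}\}$, if $j=i+2$; - either empty or $\{v_{i1}v_{j1},v_{i1}v_{j2},v_{i2}v_{j1},v_{i2}v_{j2}\}$, if $j\in\{i+3,\dots,i+\lfloor\frac m2\rfloor\}$. Let $\pi$ be the permutation of $C_1\cup\dots\cup C_m$ with $\pi(v_{ia})=v_{i-1,a}$ for all $i\in\mathbb{Z}/m\mathbb{Z}$ and $a\in\{1,2\}$. Construct a graph $\Gamma'$ from $\Gamma$ on the same vertex set as follows, leaving all other adjacencies unchanged. - For every $v\in D$ that has exactly one neighbour $w$ in each $C_i$, replace each such edge $\{v,w\}$ by $\{v,\pi(w)\}$. - For all $i\in\mathbb{Z}/m\mathbb{Z}$, simultaneously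 replace the induced subgraph on $C_i\cup C_{i+1}$ by the former induced subgraph on $C_i\cup C_{i+2}$, and replace the induced subgraph on $C_i\cup C_{i+2}$ by the former induced subgraph on $C_{i+1}\cup C_{i+2}$. Then $\Gamma'$ is $\mathbb{R}$-cospectral with $\Gamma$.
   Context: Graphs are finite, simple and loopless. Two graphs with adjacency matrices $A$ and $A'$ are $\mathbb{R}$-cospectral if $A+rJ$ and $A'+rJ$ have the same spectrum for every $r\in\mathbb{R}$, where $J$ is the all-ones matrix. "Replace the induced subgraph on $C_i\cup C_j$ by the former induced subgraph on $C_k\cup C_l$" means: in the new graph, $v_{ia}$ and $v_{jb}$ are adjacent if and only if $v_{ka}$ and $v_{lb}$ were adjacent in $\Gamma$ ($a,b\in\{1,2\}$); the sets $C_i$ themselves remain edgeless. -}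

module Defs where

open import Level using (_⊔_) renaming (suc to lsuc)
open import Algebra.Apartness.Bundles using (HeytingField; module HeytingCommutativeRing)
open import Algebra.Bundles using (module CommutativeRing)
open import Data.Bool.Base using (Bool; false; T; if_then_else_)
open import Data.Fin.Base using (Fin; zero; suc; toℕ; punchIn)
open import Data.Fin.Patterns using (0F; 1F)
open import Data.Fin.Properties
  using (_≟_; all?; nonZeroIndex; toℕ<n; toℕ-fromℕ<)
open import Data.List.Base using (List; []; _∷_; _++_; length; filterᵇ; foldr)
open import Data.List.Membership.Propositional using (_∈_)
open import Data.Nat.Base as ℕ using (ℕ; NonZero; ⌊_/2⌋)
open import Data.Nat.DivMod
  using (_%_; _mod_; m<n⇒m%n≡m; [m+n]%n≡m%n; %-distribˡ-+; m%n%n≡m%n)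
import Data.Nat.Properties as ℕ
open import Data.Product.Base using (Σ-syntax; ∃-syntax; _×_; _,_)
open import Data.Sum.Base using (_⊎_; inj₁; inj₂)
open import Function.Bundles using (_⇔_; _↔_; Inverse)
open import Relation.Binary.Core using (Rel)
open import Relation.Binary.PropositionalEquality
  using (_≡_; _≢_; refl; sym; trans; cong; subst; module ≡-Reasoning)
open import Relation.Binary.Structures using (IsStrictPartialOrder)
open import Relation.Nullary.Decidable using (yes; no; does)
open import Relation.Nullary.Negation using (contradiction)

record OrderedField c ℓ₁ ℓ₂ : Set (lsuc (c ⊔ ℓ₁ ⊔ ℓ₂)) where
  field
    heytingField : HeytingField c ℓ₁ ℓ₂

  open HeytingField heytingField public

  infix 4 _<_
  field
    _<_                  : Rel Carrier ℓ₂
    isStrictPartialOrder : IsStrictPartialOrder _≈_ _<_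
    #⇔<⊎>                : ∀ {x y} → (x # y) ⇔ (x < y ⊎ y < x)
    +-monoˡ-<            : ∀ {x y} z → x < y → x + z < y + z
    *-pos                : ∀ {x y} → 0# < x → 0# < y → 0# < x * y

  fromℕ : ℕ → Carrier
  fromℕ ℕ.zero    = 0#
  fromℕ (ℕ.suc n) = 1# + fromℕ n

  -- |x - y| < ε
  Within : Carrier → Carrier → Carrier → Set ℓ₂
  Within ε x y = (x - y < ε) × (y - x < ε)

  Cauchy : (ℕ → Carrier) → Set (c ⊔ ℓ₂)
  Cauchy s = ∀ ε → 0# < ε →
    ∃[ N ] (∀ p q → N ℕ.≤ p → N ℕ.≤ q → Within ε (s p) (s q))

  _ConvergesTo_ : (ℕ → Carrier) → Carrier → Set (c ⊔ ℓ₂)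
  s ConvergesTo l = ∀ ε → 0# < ε → ∃[ N ] (∀ p → N ℕ.≤ p → Within ε (s p) l)

-- An Archimedean, Cauchy complete ordered field: classically ℝ is the only
-- one up to isomorphism. The order is not assumed to be decidable, so that
-- constructive real numbers are instances as well.

record RealField c ℓ₁ ℓ₂ : Set (lsuc (c ⊔ ℓ₁ ⊔ ℓ₂)) where
  field
    orderedField : OrderedField c ℓ₁ ℓ₂

  open OrderedField orderedField public

  field
    archimedean : ∀ x → ∃[ n ] (x < fromℕ n)
    complete    : ∀ s → Cauchy s → ∃[ l ] (s ConvergesTo l)

record Graph (n : ℕ) : Set where
  field
    adj    : Fin n → Fin n → Bool
    symm   : ∀ x y → adj x y ≡ adj y x
    irrefl : ∀ x → adj x x ≡ false

module Spectrum {c ℓ₁ ℓ₂} (ℝ : RealField c ℓ₁ ℓ₂) where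
  open RealField ℝ hiding (zero; refl; sym; trans)
  open HeytingCommutativeRing heytingCommutativeRing using (commutativeRing)
  open CommutativeRing commutativeRing using (semiring)
  open import Algebra.Properties.Semiring.Sum semiring using (sum)
  open import Algebra.Properties.Semiring.Exp semiring using (_^_)

  Matrix : ℕ → Set c
  Matrix n = Fin n → Fin n → Carrier

  -- Laplace expansion along the first row.
  det : ∀ {n} → Matrix n → Carrier
  det {ℕ.zero}  M = 1#
  det {ℕ.suc n} M = sum λ j →
    (- 1#) ^ toℕ j * M zero j * det (λ i k → M (suc i) (punchIn j k))

  I : ∀ {n} → Matrix n
  I i j = if does (i ≟ j) then 1# else 0#

  J : ∀ {n} → Matrix n
  J i j = 1#

  -- Over the infinite field ℝ, polynomials are identified with polynomial
  -- functions: the characteristic polynomial is the function x ↦ det (xI - M).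
  charPoly : ∀ {n} → Matrix n → Carrier → Carrier
  charPoly M x = det λ i j → x * I i j - M i j

  -- Coefficients are listed from the constant term upwards.
  eval : List Carrier → Carrier → Carrier
  eval q x = foldr (λ a s → a + x * s) 0# q

  -- μ is a root of order exactly k of the characteristic polynomial of M;
  -- k = 0 means that μ is not an eigenvalue.
  HasMultiplicity : ∀ {n} → Matrix n → Carrier → ℕ → Set (c ⊔ ℓ₁ ⊔ ℓ₂)
  HasMultiplicity M μ k = Σ[ q ∈ List Carrier ]
    (∀ x → charPoly M x ≈ (x - μ) ^ k * eval q x) × (eval q μ # 0#)

  -- The matrices considered are real symmetric, so all eigenvalues are real.
  SameSpectrum : ∀ {n} → Matrix n → Matrix n → Set (c ⊔ ℓ₁ ⊔ ℓ₂)
  SameSpectrum M N = ∀ μ k → HasMultiplicity M μ k ⇔ HasMultiplicity N μ k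

  adjacencyMatrix : ∀ {n} → Graph n → Matrix n
  adjacencyMatrix Γ x y = if Graph.adj Γ x y then 1# else 0#

  Cospectral : ∀ {n} → Graph n → Graph n → Set (c ⊔ ℓ₁ ⊔ ℓ₂)
  Cospectral {n} Γ Γ′ = ∀ r → SameSpectrum (A Γ +rJ r) (A Γ′ +rJ r)
    where
    A = adjacencyMatrix
    _+rJ_ : Matrix n → Carrier → Matrix n
    (M +rJ r) x y = M x y + r * J x y

-- Fin m represents ℤ/mℤ; an element i of Fin m witnesses that m is nonzero.

infixl 6 _⊕_

_⊕_ : ∀ {m} → Fin m → ℕ → Fin m
_⊕_ {m} i k = _mod_ (toℕ i ℕ.+ k) m {{nonZeroIndex i}}

private
  toℕ-⊕ : ∀ {m} .{{_ : NonZero m}} (i : Fin m) k →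
          toℕ (i ⊕ k) ≡ (toℕ i ℕ.+ k) % m
  toℕ-⊕ i k = toℕ-fromℕ< _

  shift-%-≢ : ∀ {m} .{{_ : NonZero m}} a k → a ℕ.< m → 0 ℕ.< k → k ℕ.< m →
              (a ℕ.+ k) % m ≢ a
  shift-%-≢ {m} a k a<m 0<k k<m eq with a ℕ.+ k ℕ.<? m
  ... | yes a+k<m = ℕ.<⇒≢ (ℕ.m<m+n a 0<k) (trans (sym eq) (m<n⇒m%n≡m a+k<m))
  ... | no  a+k≮m = ℕ.<⇒≢ r<a (trans (sym r%) eq)
    where
    r = a ℕ.+ k ℕ.∸ m
    r+m : r ℕ.+ m ≡ a ℕ.+ k
    r+m = ℕ.m∸n+n≡m (ℕ.≮⇒≥ a+k≮m)
    r<a : r ℕ.< a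
    r<a = ℕ.+-cancelʳ-< m r a
            (subst (ℕ._< a ℕ.+ m) (sym r+m) (ℕ.+-monoʳ-< a k<m))
    r% : (a ℕ.+ k) % m ≡ r
    r% = trans (cong (_% m) (sym r+m))
           (trans ([m+n]%n≡m%n r m) (m<n⇒m%n≡m (ℕ.<-trans r<a a<m)))

  ⊕-≢ : ∀ {m} (i : Fin m) k → 0 ℕ.< k → k ℕ.< m → i ≢ i ⊕ k
  ⊕-≢ {ℕ.suc _} i k 0<k k<m eq =
    shift-%-≢ (toℕ i) k (toℕ<n i) 0<k k<m
      (trans (sym (toℕ-⊕ i k)) (cong toℕ (sym eq)))

  ⊕-⊕ : ∀ {m} (i : Fin m) k l → toℕ ((i ⊕ k) ⊕ l) ≡ toℕ (i ⊕ (k ℕ.+ l))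
  ⊕-⊕ {m@(ℕ.suc _)} i k l = begin
    toℕ ((i ⊕ k) ⊕ l)                        ≡⟨ toℕ-⊕ (i ⊕ k) l ⟩
    (toℕ (i ⊕ k) ℕ.+ l) % m                  ≡⟨ cong (λ t → (t ℕ.+ l) % m) (toℕ-⊕ i k) ⟩
    ((a ℕ.+ k) % m ℕ.+ l) % m                ≡⟨ %-distribˡ-+ ((a ℕ.+ k) % m) l m ⟩
    ((a ℕ.+ k) % m % m ℕ.+ l % m) % m        ≡⟨ cong (λ t → (t ℕ.+ l % m) % m) (m%n%n≡m%n (a ℕ.+ k) m) ⟩
    ((a ℕ.+ k) % m ℕ.+ l % m) % m            ≡⟨ %-distribˡ-+ (a ℕ.+ k) l m ⟨
    (a ℕ.+ k ℕ.+ l) % m                      ≡⟨ cong (_% m) (ℕ.+-assoc a k l) ⟩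
    (a ℕ.+ (k ℕ.+ l)) % m                    ≡⟨ toℕ-⊕ i (k ℕ.+ l) ⟨
    toℕ (i ⊕ (k ℕ.+ l))                      ∎
    where
    open ≡-Reasoning
    a = toℕ i

  ⊕-asym : ∀ {m} {i j : Fin m} k → 0 ℕ.< k → k ℕ.+ k ℕ.< m →
           j ≡ i ⊕ k → i ≢ j ⊕ k
  ⊕-asym {m@(ℕ.suc _)} {i} k 0<k 2k<m refl eq =
    shift-%-≢ (toℕ i) (k ℕ.+ k) (toℕ<n i)
      (ℕ.<-≤-trans 0<k (ℕ.m≤m+n k k)) 2k<m
      (trans (sym (toℕ-⊕ i (k ℕ.+ k)))
        (trans (sym (⊕-⊕ i k k)) (cong toℕ (sym eq))))

-- A partition {C₁, …, Cₘ, D} of the vertex set, where Cᵢ = {vᵢ₁, vᵢ₂} and D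
-- has d elements. The index a ∈ {1, 2} of vᵢₐ becomes 0F or 1F.

record Partition (n m : ℕ) : Set where
  field
    d         : ℕ
    labelling : Fin n ↔ ((Fin m × Fin 2) ⊎ Fin d)

  open Inverse labelling public using () renaming (to to label; from to vertex)

  v : Fin m → Fin 2 → Fin n
  v i a = vertex (inj₁ (i , a))

  D : Fin d → Fin n
  D x = vertex (inj₂ x)

  C : Fin m → List (Fin n)
  C i = v i 0F ∷ v i 1F ∷ []

module _ {n m : ℕ} (Γ : Graph n) (P : Partition n m) where
  open Graph Γ
  open Partition P

  neighboursIn : Fin n → Fin m → ℕ
  neighboursIn x i = length (filterᵇ (adj x) (C i))

  -- The edges are unordered, so E contains each of them in either orientation.
  InducedEdgeSet : List (Fin n) → List (Fin n × Fin n) → Set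
  InducedEdgeSet S E = ∀ {x y} → x ∈ S → y ∈ S →
    T (adj x y) ⇔ ((x , y) ∈ E ⊎ (y , x) ∈ E)

  record Switchable : Set where
    field
      parity : ∀ x i j → neighboursIn (D x) i % 2 ≡ neighboursIn (D x) j % 2

      offset1 : ∀ i → let j = i ⊕ 1 in
          InducedEdgeSet (C i ++ C j) ((v i 0F , v j 0F) ∷ (v i 0F , v j 1F) ∷ [])
        ⊎ InducedEdgeSet (C i ++ C j) ((v i 1F , v j 0F) ∷ (v i 1F , v j 1F) ∷ [])

      offset2 : ∀ i → let j = i ⊕ 2 in
          InducedEdgeSet (C i ++ C j) ((v i 0F , v j 0F) ∷ (v i 1F , v j 0F) ∷ [])
        ⊎ InducedEdgeSet (C i ++ C j) ((v i 0F , v j 1F) ∷ (v i 1F , v j 1F) ∷ [])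

      offset≥3 : ∀ i k → 3 ℕ.≤ k → k ℕ.≤ ⌊ m /2⌋ → let j = i ⊕ k in
          InducedEdgeSet (C i ++ C j) []
        ⊎ InducedEdgeSet (C i ++ C j)
            ( (v i 0F , v j 0F) ∷ (v i 0F , v j 1F)
            ∷ (v i 1F , v j 0F) ∷ (v i 1F , v j 1F) ∷ [])

  -- Adjacency in Γ′ of a vertex of D and vᵢₐ. An edge {x, w} becomes
  -- {x, π w}, so x is adjacent to vᵢₐ in Γ′ iff it is adjacent to
  -- π⁻¹ vᵢₐ = v₍ᵢ₊₁₎ₐ in Γ.
  switchD : Fin d → Fin m → Fin 2 → Bool
  switchD x i a =
    if does (all? λ j → neighboursIn (D x) j ℕ.≟ 1)
    then adj (D x) (v (i ⊕ 1) a)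
    else adj (D x) (v i a)

  -- Adjacency in Γ′ of vᵢₐ and vⱼᵦ. Each of the two replacements appears
  -- twice, once for j following i and once for i following j.
  switchC : Fin m → Fin 2 → Fin m → Fin 2 → Bool
  switchC i a j b =
    if does (j ≟ i ⊕ 1) then adj (v i a) (v (i ⊕ 2) b) else
    if does (i ≟ j ⊕ 1) then adj (v j b) (v (j ⊕ 2) a) else
    if does (j ≟ i ⊕ 2) then adj (v (i ⊕ 1) a) (v (i ⊕ 2) b) else
    if does (i ≟ j ⊕ 2) then adj (v (j ⊕ 1) b) (v (j ⊕ 2) a) else
    adj (v i a) (v j b)

  switchAdj : (x y : (Fin m × Fin 2) ⊎ Fin d) → Bool
  switchAdj (inj₁ (i , a)) (inj₁ (j , b)) = switchC i a j b
  switchAdj (inj₁ (i , a)) (inj₂ y)       = switchD y i a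
  switchAdj (inj₂ x)       (inj₁ (j , b)) = switchD x j b
  switchAdj (inj₂ x)       (inj₂ y)       = adj (D x) (D y)

  module _ (m≥5 : m ℕ.≥ 5) where
    private
      0<1 : 0 ℕ.< 1
      0<1 = ℕ.s≤s ℕ.z≤n

      0<2 : 0 ℕ.< 2
      0<2 = ℕ.s≤s ℕ.z≤n

      k<m : ∀ k {_ : T (k ℕ.<ᵇ 5)} → k ℕ.< m
      k<m k {k<5} = ℕ.<-≤-trans (ℕ.<ᵇ⇒< k 5 k<5) m≥5

      switchC-symm : ∀ i a j b → switchC i a j b ≡ switchC j b i a
      switchC-symm i a j b
        with j ≟ i ⊕ 1 | i ≟ j ⊕ 1 | j ≟ i ⊕ 2 | i ≟ j ⊕ 2
      ... | yes p | yes q | _     | _     =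
        contradiction q (⊕-asym 1 0<1 (k<m 2) p)
      ... | yes _ | no _  | _     | _     = refl
      ... | no _  | yes _ | _     | _     = refl
      ... | no _  | no _  | yes p | yes q =
        contradiction q (⊕-asym 2 0<2 (k<m 4) p)
      ... | no _  | no _  | yes _ | no _  = refl
      ... | no _  | no _  | no _  | yes _ = refl
      ... | no _  | no _  | no _  | no _  = symm (v i a) (v j b)

      switchC-irrefl : ∀ i a → switchC i a i a ≡ false
      switchC-irrefl i a with i ≟ i ⊕ 1 | i ≟ i ⊕ 2
      ... | yes p | _     = contradiction p (⊕-≢ i 1 0<1 (k<m 1))
      ... | no _  | yes p = contradiction p (⊕-≢ i 2 0<2 (k<m 2))
      ... | no _  | no _  = irrefl (v i a)

      switchAdj-symm : ∀ x y → switchAdj x y ≡ switchAdj y x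
      switchAdj-symm (inj₁ (i , a)) (inj₁ (j , b)) = switchC-symm i a j b
      switchAdj-symm (inj₁ _)       (inj₂ _)       = refl
      switchAdj-symm (inj₂ _)       (inj₁ _)       = refl
      switchAdj-symm (inj₂ x)       (inj₂ y)       = symm (D x) (D y)

      switchAdj-irrefl : ∀ x → switchAdj x x ≡ false
      switchAdj-irrefl (inj₁ (i , a)) = switchC-irrefl i a
      switchAdj-irrefl (inj₂ x)       = irrefl (D x)

    switch : Graph n
    switch = record
      { adj    = λ x y → switchAdj (label x) (label y)
      ; symm   = λ x y → switchAdj-symm (label x) (label y)
      ; irrefl = λ x → switchAdj-irrefl (label x)
      }

{-# OPTIONS --safe #-}

-- Let Q be the orthogonal matrix that fixes the vertices of D and acts on functions
-- on C₁ ∪ … ∪ Cₘ by (Q f)(vᵢₐ) = (mean of f on Cᵢ) + (deviation of f(vᵢ₊₁,ₐ) from its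
-- mean on Cᵢ₊₁): it shifts the deviations cyclically and leaves the means alone.
-- By (iii), deviations are seen only between Cᵢ and Cᵢ₊₁ (on the side of Cᵢ) and
-- between Cᵢ and Cᵢ₊₂ (on the side of Cᵢ₊₂), and the switching is exactly their
-- shift, so the new adjacency matrix is Q A Qᵀ. As Q I Qᵀ = I and Q J Qᵀ = J,
-- multiplicativity of the determinant yields equal characteristic polynomials.

module Submission where

open import Algebra.Apartness.Bundles using (module HeytingCommutativeRing)
open import Algebra.Bundles using (CommutativeRing)
open import Data.Bool.Base using (Bool; true; false; T; if_then_else_)
open import Data.Empty using (⊥-elim)
open import Data.Fin.Base using (Fin; zero; suc; toℕ; opposite; punchIn; punchOut)
open import Data.Fin.Patterns using (0F; 1F)
open import Data.Fin.Properties
  using (_≟_; all?; punchIn-punchOut; punchInᵢ≢i; suc-injective; toℕ<n; toℕ-fromℕ<; toℕ-injective)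
open import Data.Nat.Base as ℕ using (ℕ; NonZero; ⌊_/2⌋; ⌈_/2⌉; _≥_)
open import Data.Nat.DivMod using (_%_; m<n⇒m%n≡m; [m+n]%n≡m%n; %-distribˡ-+; m%n%n≡m%n)
import Data.Nat.Properties as ℕ
open import Data.Product.Base using (Σ-syntax; ∃-syntax; _×_; _,_; proj₁; proj₂)
open import Data.Product.Properties using (,-injective)
open import Data.Sum.Base using (_⊎_; inj₁; inj₂; [_,_]′)
open import Data.Sum.Properties using (inj₁-injective)
open import Function.Base using (_∘_)
open import Function.Bundles using (Inverse; Equivalence; mk⇔)
open import Level using (_⊔_)
open import Relation.Binary.Definitions using (tri<; tri≈; tri>)
open import Relation.Binary.PropositionalEquality as ≡ using (_≡_; _≢_)
open import Relation.Binary.Structures using (IsStrictPartialOrder)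
open import Relation.Nullary.Decidable using (Dec; yes; no; does; dec-true; dec-false)
open import Relation.Nullary.Negation using (contradiction)
open import Defs

-- Determinants

-- Every block between two of the sets Cᵢ depends on at most one of its two indices, so no block has
-- a deviation in rows and columns at once. The conjugated entry at (i, j) therefore has three
-- sources: the mean of block (i, j), the column deviation of block (i, j + 1) and the row deviation
-- of block (i + 1, j). All blocks at offsets ±1 and ±2 have mean 1/2, so exchanging them is
-- invisible to the means. The bound m ≥ 5 makes the offsets 0, ±1, ±2 distinct modulo m. The
-- spectrum is read off `det`, which is defined by expansion along the first row. Its
-- multiplicativity comes from the fact that an alternating form in the rows is determined by its
-- value at `I`; orthogonality of Q is then used in the form `det Q * det Qᵀ ≈ 1#`.

module Determinant {c ℓ₁ ℓ₂} (ℝ : RealField c ℓ₁ ℓ₂) where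
  open Spectrum ℝ
  open HeytingCommutativeRing (RealField.heytingCommutativeRing ℝ) using (commutativeRing)
  open CommutativeRing commutativeRing
    hiding (zero)
  open import Algebra.Properties.Ring ring
    using (-1*x≈-x; x+x≈x⇒x≈0; +-inverseˡ-unique)
  open import Algebra.Properties.Semiring.Sum semiring
    using (sum; sum-cong-≋; sum-replicate-zero; ∑-distrib-+; *-distribˡ-sum; *-distribʳ-sum)
  open import Algebra.Properties.Semiring.Exp semiring using (_^_)
  open import Data.Vec.Functional using (_∷_; insertAt)
  open import Data.Vec.Functional.Properties using (insertAt-lookup; insertAt-punchIn)
  open import Relation.Binary.Reasoning.Setoid setoid

  open import Algebra.Solver.Ring.NaturalCoefficients.Default commutativeSemiring
    using (solve; _:=_; _:+_; _:*_; con)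

  -- Alternating forms in the rows of a matrix.

  Row : ℕ → Set c
  Row n = Fin n → Carrier

  infix 4 _≋_
  _≋_ : ∀ {n} → Row n → Row n → Set ℓ₁
  u ≋ v = ∀ l → u l ≈ v l

  -- `linear` relates three families that agree off row `i`, instead of using an operation that
  -- replaces a row; this suits rows that are equal only up to `≈`. The number `k` of rows may
  -- differ from their length `n`, because fixing the first row of a square matrix leaves such a
  -- family.
  record IsAlternating {k n} (f : (Fin k → Row n) → Carrier) : Set (c ⊔ ℓ₁) where
    field
      cong-rows   : ∀ {A B} → (∀ p → A p ≋ B p) → f A ≈ f B
      linear      : ∀ i a {A B C} → (∀ l → A i l ≈ a * B i l + C i l) →
                    (∀ p → p ≢ i → A p ≋ B p) → (∀ p → p ≢ i → A p ≋ C p) →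
                    f A ≈ a * f B + f C
      alternating : ∀ {i j} {A} → i ≢ j → A i ≋ A j → f A ≈ 0#

  ∷-cong : ∀ {k n} {A B : Fin (ℕ.suc k) → Row n} →
           A zero ≋ B zero → (∀ p → A (suc p) ≋ B (suc p)) → ∀ p → A p ≋ B p
  ∷-cong e es zero    = e
  ∷-cong e es (suc p) = es p

  fix-row : ∀ {k n} {f : (Fin (ℕ.suc k) → Row n) → Carrier} → IsAlternating f →
            ∀ u → IsAlternating (λ A → f (u ∷ A))
  fix-row alt u = record
    { cong-rows   = λ {A} {B} e → cong-rows (∷-cong {A = u ∷ A} {B = u ∷ B} (λ _ → refl) e)
    ; linear      = λ i a {A} {B} {C} e b c → linear (suc i) a {u ∷ A} {u ∷ B} {u ∷ C} e
        (λ { zero _ _ → refl ; (suc p) p≢i → b p (p≢i ∘ ≡.cong suc) })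
        (λ { zero _ _ → refl ; (suc p) p≢i → c p (p≢i ∘ ≡.cong suc) })
    ; alternating = λ i≢j → alternating (i≢j ∘ suc-injective)
    }
    where open IsAlternating alt

  module _ {k n} {f : (Fin k → Row n) → Carrier} (alt : IsAlternating f) where
    open IsAlternating alt

    -- Expand 0 = f (…, x + y, …, x + y, …).
    antisymmetric : ∀ {i j A B} → i ≢ j → A i ≋ B j → A j ≋ B i →
                    (∀ p → p ≢ i → p ≢ j → A p ≋ B p) → f A + f B ≈ 0#
    antisymmetric {i} {j} {A} {B} i≢j ij ji rest = begin
      f A + f B
        ≈⟨ +-cong (cong-rows A≋) (cong-rows B≋) ⟩
      F x y + F y x
        ≈⟨ +-cong (+-identityˡ _) (+-identityʳ _) ⟨
      (0# + F x y) + (F y x + 0#)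
        ≈⟨ +-cong (+-congʳ (diag x)) (+-congˡ (diag y)) ⟨
      (F x x + F x y) + (F y x + F y y)
        ≈⟨ +-cong (addʳ x) (addʳ y) ⟨
      F x s + F y s
        ≈⟨ addˡ ⟨
      F s s
        ≈⟨ diag s ⟩
      0# ∎
      where
      x = A i
      y = A j
      s = λ l → x l + y l
      R : Row n → Row n → Fin k → Row n
      R u w p with p ≟ i | p ≟ j
      ... | yes _ | _     = u
      ... | no _  | yes _ = w
      ... | no _  | no _  = A p
      F : Row n → Row n → Carrier
      F u w = f (R u w)
      Ri : ∀ u w → R u w i ≡ u
      Ri u w with i ≟ i
      ... | yes _  = ≡.refl
      ... | no i≢i = contradiction ≡.refl i≢i
      Rj : ∀ u w → R u w j ≡ w
      Rj u w with j ≟ i | j ≟ j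
      ... | yes j≡i | _      = contradiction (≡.sym j≡i) i≢j
      ... | no _    | yes _  = ≡.refl
      ... | no _    | no j≢j = contradiction ≡.refl j≢j
      R-congˡ : ∀ {u u′} w p → p ≢ i → R u w p ≋ R u′ w p
      R-congˡ w p p≢i l with p ≟ i | p ≟ j
      ... | yes p≡i | _     = contradiction p≡i p≢i
      ... | no _    | yes _ = refl
      ... | no _    | no _  = refl
      R-congʳ : ∀ {w w′} u p → p ≢ j → R u w p ≋ R u w′ p
      R-congʳ u p p≢j l with p ≟ i | p ≟ j
      ... | yes _ | _       = refl
      ... | no _  | yes p≡j = contradiction p≡j p≢j
      ... | no _  | no _    = refl
      A≋ : ∀ p → A p ≋ R x y p
      A≋ p l with p ≟ i | p ≟ j
      ... | yes ≡.refl | _          = refl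
      ... | no _       | yes ≡.refl = refl
      ... | no _       | no _       = refl
      B≋ : ∀ p → B p ≋ R y x p
      B≋ p l with p ≟ i | p ≟ j
      ... | yes ≡.refl | _          = sym (ji l)
      ... | no _       | yes ≡.refl = sym (ij l)
      ... | no p≢i     | no p≢j     = sym (rest p p≢i p≢j l)
      diag : ∀ u → F u u ≈ 0#
      diag u = alternating i≢j λ l →
        reflexive (≡.cong (λ r → r l) (≡.trans (Ri u u) (≡.sym (Rj u u))))
      sum-row : ∀ {u v w : Row n} → u ≡ s → v ≡ x → w ≡ y →
                ∀ l → u l ≈ 1# * v l + w l
      sum-row ≡.refl ≡.refl ≡.refl l = +-congʳ (sym (*-identityˡ _))
      addʳ : ∀ u → F u s ≈ F u x + F u y
      addʳ u = trans
        (linear j 1# (sum-row (Rj u s) (Rj u x) (Rj u y))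
          (R-congʳ u) (R-congʳ u))
        (+-congʳ (*-identityˡ _))
      addˡ : F s s ≈ F x s + F y s
      addˡ = trans
        (linear i 1# (sum-row (Ri s s) (Ri x s) (Ri y s))
          (R-congˡ s) (R-congˡ s))
        (+-congʳ (*-identityˡ _))

  -- Removing columns j and then k removes the same two columns as j′ and then k′.
  data Flip : ∀ {n} → Fin (ℕ.suc n) → Fin n → Fin (ℕ.suc n) → Fin n → Set where
    here  : ∀ {n} (k : Fin (ℕ.suc n)) → Flip zero k (suc k) zero
    there : ∀ {n j k j′ k′} → Flip {n} j k j′ k′ →
            Flip (suc j) (suc k) (suc j′) (suc k′)

  flip-col₁ : ∀ {n j k j′ k′} → Flip {n} j k j′ k′ → punchIn j k ≡ j′
  flip-col₁ (here k)  = ≡.refl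
  flip-col₁ (there φ) = ≡.cong suc (flip-col₁ φ)

  flip-col₂ : ∀ {n j k j′ k′} → Flip {n} j k j′ k′ → j ≡ punchIn j′ k′
  flip-col₂ (here k)  = ≡.refl
  flip-col₂ (there φ) = ≡.cong suc (flip-col₂ φ)

  flip-cols : ∀ {n j k j′ k′} → Flip {ℕ.suc n} j k j′ k′ →
              ∀ l → punchIn j (punchIn k l) ≡ punchIn j′ (punchIn k′ l)
  flip-cols (here k)          l       = ≡.refl
  flip-cols (there φ)         zero    = ≡.refl
  flip-cols {ℕ.suc n} (there φ) (suc l) = ≡.cong suc (flip-cols φ l)

  -- The index sums of the two orders have opposite parity: `here` pairs the sums `k` and `k + 1`,
  -- and `there` adds 2 to both.
  neg-one-flip : ∀ {n j k j′ k′} → Flip {n} j k j′ k′ →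
    (- 1#) ^ toℕ j′ * (- 1#) ^ toℕ k′ ≈ - 1# * ((- 1#) ^ toℕ j * (- 1#) ^ toℕ k)
  neg-one-flip (here k) =
    solve 2 (λ x s → x :* s :* con 1 := x :* (con 1 :* s)) refl (- 1#) ((- 1#) ^ toℕ k)
  neg-one-flip {j = suc j} {suc k} {suc j′} {suc k′} (there φ) = begin
    - 1# * (- 1#) ^ toℕ j′ * (- 1# * (- 1#) ^ toℕ k′)
      ≈⟨ solve 3 (λ x s t → x :* s :* (x :* t) := x :* (x :* (s :* t))) refl (- 1#) _ _ ⟩
    - 1# * (- 1# * ((- 1#) ^ toℕ j′ * (- 1#) ^ toℕ k′))
      ≈⟨ *-congˡ (*-congˡ (neg-one-flip φ)) ⟩
    - 1# * (- 1# * (- 1# * ((- 1#) ^ toℕ j * (- 1#) ^ toℕ k)))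
      ≈⟨ solve 3 (λ x s t → x :* (x :* (x :* (s :* t))) := x :* (x :* s :* (x :* t))) refl (- 1#) _ _ ⟩
    - 1# * (- 1# * (- 1#) ^ toℕ j * (- 1# * (- 1#) ^ toℕ k)) ∎

  sum-zero : ∀ {n} {u : Row n} → (∀ j → u j ≈ 0#) → sum u ≈ 0#
  sum-zero {n} e = trans (sum-cong-≋ e) (sum-replicate-zero n)

  -- By `here`, the terms with `j = 0` cancel those with `k = 0` and `j > 0`. The remaining terms
  -- are indexed by successors in both places and form the same kind of sum, one size smaller.
  sum-flip : ∀ {n} (F : Fin (ℕ.suc n) → Fin n → Carrier) →
             (∀ {j k j′ k′} → Flip j k j′ k′ → F j k + F j′ k′ ≈ 0#) →
             sum (λ j → sum (F j)) ≈ 0#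
  sum-flip {ℕ.zero}  F anti = +-identityˡ 0#
  sum-flip {ℕ.suc n} F anti = begin
    sum (F zero) + sum (λ j → F (suc j) zero + sum (λ k → F (suc j) (suc k)))
      ≈⟨ +-congˡ (∑-distrib-+ (λ j → F (suc j) zero) (λ j → sum (λ k → F (suc j) (suc k)))) ⟩
    sum (F zero) + (sum (λ j → F (suc j) zero) + sum (λ j → sum (λ k → F (suc j) (suc k))))
      ≈⟨ +-congˡ (+-congˡ (sum-flip (λ j k → F (suc j) (suc k)) (anti ∘ there))) ⟩
    sum (F zero) + (sum (λ j → F (suc j) zero) + 0#)
      ≈⟨ +-congˡ (+-identityʳ _) ⟩
    sum (F zero) + sum (λ j → F (suc j) zero)
      ≈⟨ ∑-distrib-+ (F zero) (λ k → F (suc k) zero) ⟨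
    sum (λ k → F zero k + F (suc k) zero)
      ≈⟨ sum-zero (anti ∘ here) ⟩
    0# ∎

  sum-linear : ∀ {n} a {u v w : Row n} → (∀ j → u j ≈ a * v j + w j) →
               sum u ≈ a * sum v + sum w
  sum-linear a {u} {v} {w} e = begin
    sum u                       ≈⟨ sum-cong-≋ e ⟩
    sum (λ j → a * v j + w j)   ≈⟨ ∑-distrib-+ (λ j → a * v j) w ⟩
    sum (λ j → a * v j) + sum w ≈⟨ +-congʳ (*-distribˡ-sum a v) ⟨
    a * sum v + sum w           ∎

  -- The Laplace expansion as an alternating form.

  minor : ∀ {n} → Fin (ℕ.suc n) → Matrix (ℕ.suc n) → Matrix n
  minor j A i l = A (suc i) (punchIn j l)

  -- The first two rows being equal, the terms for the two orders of removing two columns cancel.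
  det-first-two-rows : ∀ {n} (A : Matrix (ℕ.suc (ℕ.suc n))) →
    (∀ {B C : Matrix n} → (∀ p → B p ≋ C p) → det B ≈ det C) →
    A zero ≋ A (suc zero) → det A ≈ 0#
  det-first-two-rows {n} A det-cong e =
    trans (sum-cong-≋ (λ j → *-distribˡ-sum (s (toℕ j) * A zero j)
        (λ k → s (toℕ k) * A (suc zero) (punchIn j k) * m j k)))
      (sum-flip (λ j k → s (toℕ j) * A zero j * (s (toℕ k) * A (suc zero) (punchIn j k) * m j k)) anti)
    where
    s : ℕ → Carrier
    s p = (- 1#) ^ p
    m : Fin (ℕ.suc (ℕ.suc n)) → Fin (ℕ.suc n) → Carrier
    m j k = det (minor k (minor j A))
    lemma : ∀ a b x y d → a * x * (b * y * d) ≈ a * b * (x * y * d)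
    lemma = solve 5 (λ a b x y d → a :* x :* (b :* y :* d) := a :* b :* (x :* y :* d)) refl
    anti : ∀ {j k j′ k′} → Flip j k j′ k′ →
      s (toℕ j) * A zero j * (s (toℕ k) * A (suc zero) (punchIn j k) * m j k) +
      s (toℕ j′) * A zero j′ * (s (toℕ k′) * A (suc zero) (punchIn j′ k′) * m j′ k′) ≈ 0#
    anti {j} {k} {j′} {k′} φ = begin
      s (toℕ j) * A zero j * (s (toℕ k) * A (suc zero) (punchIn j k) * m j k) +
      s (toℕ j′) * A zero j′ * (s (toℕ k′) * A (suc zero) (punchIn j′ k′) * m j′ k′)
        ≈⟨ +-cong (lemma (s (toℕ j)) (s (toℕ k)) (A zero j) (A (suc zero) (punchIn j k)) (m j k))
                  (lemma (s (toℕ j′)) (s (toℕ k′)) (A zero j′) (A (suc zero) (punchIn j′ k′)) (m j′ k′)) ⟩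
      σ * τ + s (toℕ j′) * s (toℕ k′) * (A zero j′ * A (suc zero) (punchIn j′ k′) * m j′ k′)
        ≈⟨ +-congˡ (*-cong (neg-one-flip φ) (*-cong (trans (*-cong x y) (*-comm _ _)) mm)) ⟩
      σ * τ + (- 1# * σ) * τ
        ≈⟨ +-congˡ (trans (*-assoc _ _ _) (-1*x≈-x _)) ⟩
      σ * τ - σ * τ
        ≈⟨ -‿inverseʳ (σ * τ) ⟩
      0# ∎
      where
      σ = s (toℕ j) * s (toℕ k)
      τ = A zero j * A (suc zero) (punchIn j k) * m j k
      x : A zero j′ ≈ A (suc zero) (punchIn j k)
      x = trans (e j′) (reflexive (≡.cong (A (suc zero)) (≡.sym (flip-col₁ φ))))
      y : A (suc zero) (punchIn j′ k′) ≈ A zero j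
      y = trans (sym (e _)) (reflexive (≡.cong (A zero) (≡.sym (flip-col₂ φ))))
      mm : m j′ k′ ≈ m j k
      mm = det-cong λ p l → reflexive (≡.cong (A (suc (suc p))) (≡.sym (flip-cols φ l)))

  -- Congruence, linearity and the vanishing for two equal lower rows pass through the expansion by
  -- induction. The expansion singles out the first row, so the real work lies in the case where one
  -- of the two equal rows is the first.
  det-isAlternating : ∀ n → IsAlternating (det {n})
  det-isAlternating ℕ.zero = record
    { cong-rows = λ _ → refl ; linear = λ () ; alternating = λ { {()} } }
  det-isAlternating (ℕ.suc n) = record
    { cong-rows   = cong-rows′
    ; linear      = linear′
    ; alternating = λ {i} {j} {A} → alternating′ i j A
    }
    where
    open IsAlternating (det-isAlternating n)

    cong-rows′ : ∀ {A B : Matrix (ℕ.suc n)} → (∀ p → A p ≋ B p) → det A ≈ det B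
    cong-rows′ e = sum-cong-≋ λ j →
      *-cong (*-congˡ {(- 1#) ^ toℕ j} (e zero j)) (cong-rows λ p l → e (suc p) (punchIn j l))

    linear′ : ∀ i a {A B C : Matrix (ℕ.suc n)} → (∀ l → A i l ≈ a * B i l + C i l) →
              (∀ p → p ≢ i → A p ≋ B p) → (∀ p → p ≢ i → A p ≋ C p) →
              det A ≈ a * det B + det C
    linear′ zero a {A} {B} {C} e b c = sum-linear a λ j → begin
      s j * A zero j * det (minor j A)
        ≈⟨ *-congʳ (*-congˡ (e j)) ⟩
      s j * (a * B zero j + C zero j) * det (minor j A)
        ≈⟨ lemma (s j) a (B zero j) (C zero j) (det (minor j A)) ⟩
      a * (s j * B zero j * det (minor j A)) + s j * C zero j * det (minor j A)
        ≈⟨ +-cong (*-congˡ (*-congˡ {s j * B zero j} (cong-rows λ p l → b (suc p) (λ ()) (punchIn j l))))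
                  (*-congˡ {s j * C zero j} (cong-rows λ p l → c (suc p) (λ ()) (punchIn j l))) ⟩
      a * (s j * B zero j * det (minor j B)) + s j * C zero j * det (minor j C) ∎
      where
      s : Fin (ℕ.suc n) → Carrier
      s j = (- 1#) ^ toℕ j
      lemma : ∀ s a x y d → s * (a * x + y) * d ≈ a * (s * x * d) + s * y * d
      lemma = solve 5 (λ s a x y d →
        s :* (a :* x :+ y) :* d := a :* (s :* x :* d) :+ s :* y :* d) refl
    linear′ (suc i) a {A} {B} {C} e b c = sum-linear a λ j → begin
      s j * A zero j * det (minor j A)
        ≈⟨ *-congˡ {s j * A zero j} (linear i a (λ l → e (punchIn j l))
             (λ p p≢i l → b (suc p) (p≢i ∘ suc-injective) (punchIn j l))
             (λ p p≢i l → c (suc p) (p≢i ∘ suc-injective) (punchIn j l))) ⟩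
      s j * A zero j * (a * det (minor j B) + det (minor j C))
        ≈⟨ lemma (s j * A zero j) a (det (minor j B)) (det (minor j C)) ⟩
      a * (s j * A zero j * det (minor j B)) + s j * A zero j * det (minor j C)
        ≈⟨ +-cong (*-congˡ (*-congʳ (*-congˡ (b zero (λ ()) j))))
                  (*-congʳ (*-congˡ (c zero (λ ()) j))) ⟩
      a * (s j * B zero j * det (minor j B)) + s j * C zero j * det (minor j C) ∎
      where
      s : Fin (ℕ.suc n) → Carrier
      s j = (- 1#) ^ toℕ j
      lemma : ∀ s a x y → s * (a * x + y) ≈ a * (s * x) + s * y
      lemma = solve 4 (λ s a x y → s :* (a :* x :+ y) := a :* (s :* x) :+ s :* y) refl

    -- Takes the place of `fix-row` while alternation at size `suc n` is still being proved: two
    -- equal lower rows stay equal in every minor, so each term of the expansion vanishes by the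
    -- induction hypothesis.
    fixed : ∀ (u : Row (ℕ.suc n)) → IsAlternating (λ (A : Fin n → Row (ℕ.suc n)) → det (u ∷ A))
    fixed u = record
      { cong-rows   = λ {A} {B} e → cong-rows′ (∷-cong {A = u ∷ A} {B = u ∷ B} (λ _ → refl) e)
      ; linear      = λ i a {A} {B} {C} e b c → linear′ (suc i) a {u ∷ A} {u ∷ B} {u ∷ C} e
          (λ { zero _ _ → refl ; (suc p) p≢i → b p (p≢i ∘ ≡.cong suc) })
          (λ { zero _ _ → refl ; (suc p) p≢i → c p (p≢i ∘ ≡.cong suc) })
      ; alternating = λ {_} {_} {A} i≢j e → sum-zero λ j →
          trans (*-congˡ {(- 1#) ^ toℕ j * u j} (alternating {A = minor j (u ∷ A)} i≢j (e ∘ punchIn j)))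
            (zeroʳ _)
      }

    -- For the second row this is the cancellation in the double expansion. For a later row, `V′`
    -- swaps that row into second place; by antisymmetry in the lower rows the swap only changes the
    -- sign.
    equal-to-first : ∀ q (A : Matrix (ℕ.suc n)) → A zero ≋ A (suc q) → det A ≈ 0#
    equal-to-first zero A e = det-first-two-rows A (IsAlternating.cong-rows (det-isAlternating _)) e
    equal-to-first (suc q) A e = begin
      det A                    ≈⟨ cong-rows′ {A} {u ∷ V} (∷-cong (λ _ → refl) (λ _ _ → refl)) ⟩
      det (u ∷ V)              ≈⟨ +-identityʳ _ ⟨
      det (u ∷ V) + 0#         ≈⟨ +-congˡ (det-first-two-rows (u ∷ V′)
                                    (IsAlternating.cong-rows (det-isAlternating _)) e) ⟨
      det (u ∷ V) + det (u ∷ V′)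
        ≈⟨ antisymmetric (fixed u) {A = V} {B = V′} (λ ()) V₀ (λ _ → refl) V₊ ⟩
      0#                       ∎
      where
      u = A zero
      V = A ∘ suc
      V′ : Fin n → Row (ℕ.suc n)
      V′ zero    = V (suc q)
      V′ (suc p) with p ≟ q
      ... | yes _ = V zero
      ... | no _  = V (suc p)
      V₀ : V zero ≋ V′ (suc q)
      V₀ l with q ≟ q
      ... | yes _  = refl
      ... | no q≢q = contradiction ≡.refl q≢q
      V₊ : ∀ p → p ≢ zero → p ≢ suc q → V p ≋ V′ p
      V₊ zero    p≢0 _   = contradiction ≡.refl p≢0
      V₊ (suc p) _   p≢q l with p ≟ q
      ... | yes p≡q = contradiction (≡.cong suc p≡q) p≢q
      ... | no _    = refl

    alternating′ : ∀ i j (A : Matrix (ℕ.suc n)) → i ≢ j → A i ≋ A j → det A ≈ 0#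
    alternating′ zero    zero    A i≢j e = contradiction ≡.refl i≢j
    alternating′ zero    (suc j) A i≢j e = equal-to-first j A e
    alternating′ (suc i) zero    A i≢j e = equal-to-first i A (sym ∘ e)
    alternating′ (suc i) (suc j) A i≢j e =
      trans (cong-rows′ {A} {A zero ∷ A ∘ suc} (∷-cong (λ _ → refl) (λ _ _ → refl)))
        (IsAlternating.alternating (fixed (A zero)) (i≢j ∘ ≡.cong suc) e)

  det-cong : ∀ {n} {A B : Matrix n} → (∀ p → A p ≋ B p) → det A ≈ det B
  det-cong = IsAlternating.cong-rows (det-isAlternating _)

  -- Uniqueness of alternating forms.

  functional-expansion : ∀ {n} (φ : Row n → Carrier) →
    (∀ {u v} → u ≋ v → φ u ≈ φ v) →
    (∀ a u v → φ (λ l → a * u l + v l) ≈ a * φ u + φ v) →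
    ∀ u → φ u ≈ sum (λ j → u j * φ (I j))
  -- The sum is empty, so `φ u` has to vanish. All rows of length 0 agree, hence linearity with
  -- coefficient 1 gives `φ u + φ u ≈ φ u`.
  functional-expansion {ℕ.zero} φ φ-cong φ-linear u = x+x≈x⇒x≈0 (φ u) (begin
    φ u + φ u                 ≈⟨ +-congʳ (*-identityˡ (φ u)) ⟨
    1# * φ u + φ u            ≈⟨ φ-linear 1# u u ⟨
    φ (λ l → 1# * u l + u l)  ≈⟨ φ-cong (λ ()) ⟩
    φ u                       ∎)
  functional-expansion {ℕ.suc n} φ φ-cong φ-linear u = begin
    φ u
      ≈⟨ φ-cong head+tail ⟩
    φ (λ l → u zero * I zero l + (0# ∷ u ∘ suc) l)
      ≈⟨ φ-linear (u zero) (I zero) (0# ∷ u ∘ suc) ⟩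
    u zero * φ (I zero) + φ (0# ∷ u ∘ suc)
      ≈⟨ +-congˡ (functional-expansion (λ w → φ (0# ∷ w))
           (λ e → φ-cong λ { zero → refl ; (suc l) → e l })
           (λ a v w → trans (φ-cong (λ { zero → sym (trans (+-identityʳ _) (zeroʳ a)) ; (suc _) → refl }))
                        (φ-linear a (0# ∷ v) (0# ∷ w)))
           (u ∘ suc)) ⟩
    u zero * φ (I zero) + sum (λ j → u (suc j) * φ (0# ∷ I j))
      ≈⟨ +-congˡ (sum-cong-≋ λ j → *-congˡ {u (suc j)} (φ-cong λ { zero → refl ; (suc _) → refl })) ⟩
    u zero * φ (I zero) + sum (λ j → u (suc j) * φ (I (suc j))) ∎
    where
    head+tail : u ≋ λ l → u zero * I zero l + (0# ∷ u ∘ suc) l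
    head+tail zero    = sym (trans (+-identityʳ _) (*-identityʳ _))
    head+tail (suc l) = sym (trans (+-congʳ (zeroʳ _)) (+-identityˡ _))

  -- Rows are replaced one at a time from the top: once the first has changed, it becomes part of
  -- the form, and the induction concerns the form in the remaining rows.
  rowwise : ∀ {k n ℓ} (_~_ : Row n → Row n → Set ℓ) (f : (Fin k → Row n) → Carrier) →
    (∀ {A B} → (∀ p → A p ≋ B p) → f A ≈ f B) →
    (∀ i {A B} → A i ~ B i → (∀ p → p ≢ i → A p ≋ B p) → f A ≈ f B) →
    ∀ {A B} → (∀ i → A i ~ B i) → f A ≈ f B
  rowwise {ℕ.zero}  _~_ f f-cong f-row r = f-cong λ ()
  rowwise {ℕ.suc k} _~_ f f-cong f-row {A} {B} r = begin
    f A                 ≈⟨ f-row zero (r zero) (λ { zero 0≢0 → contradiction ≡.refl 0≢0 ; (suc _) _ _ → refl }) ⟩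
    f (B zero ∷ A ∘ suc)
      ≈⟨ rowwise _~_ (λ T → f (B zero ∷ T))
           (λ {T} {U} e → f-cong (∷-cong {A = B zero ∷ T} {B zero ∷ U} (λ _ → refl) e))
           (λ i s e → f-row (suc i) s
             λ { zero _ _ → refl ; (suc p) p≢i → e p (p≢i ∘ ≡.cong suc) })
           (r ∘ suc) ⟩
    f (B zero ∷ B ∘ suc) ≈⟨ f-cong (∷-cong (λ _ → refl) (λ _ _ → refl)) ⟩
    f B                 ∎

  -- Changing one row adds `a` times a value of `f` with `u` in two places, which is zero.
  add-first-row : ∀ {k n} {f : (Fin (ℕ.suc k) → Row n) → Carrier} → IsAlternating f →
    ∀ u {A B} → (∀ i → Σ[ a ∈ Carrier ] (∀ l → A i l ≈ a * u l + B i l)) →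
    f (u ∷ A) ≈ f (u ∷ B)
  add-first-row {k} {n} {f} alt u = rowwise
    (λ v w → Σ[ a ∈ Carrier ] (∀ l → v l ≈ a * u l + w l))
    (λ A → f (u ∷ A)) (IsAlternating.cong-rows (fix-row alt u)) single
    where
    open IsAlternating alt
    single : ∀ i {A B : Fin k → Row n} → Σ[ a ∈ Carrier ] (∀ l → A i l ≈ a * u l + B i l) →
             (∀ p → p ≢ i → A p ≋ B p) → f (u ∷ A) ≈ f (u ∷ B)
    single i {A} {B} (a , e) A≋B = begin
      f (u ∷ A)                 ≈⟨ IsAlternating.linear (fix-row alt u) i a eᵢ A≋B′ A≋B ⟩
      a * f (u ∷ B′) + f (u ∷ B) ≈⟨ +-congʳ (*-congˡ (alternating {zero} {suc i} (λ ()) B′ᵢ)) ⟩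
      a * 0# + f (u ∷ B)        ≈⟨ +-congʳ (zeroʳ a) ⟩
      0# + f (u ∷ B)            ≈⟨ +-identityˡ _ ⟩
      f (u ∷ B)                 ∎
      where
      B′ : Fin k → Row n
      B′ p with p ≟ i
      ... | yes _ = u
      ... | no _  = B p
      B′ᵢ : u ≋ B′ i
      B′ᵢ l with i ≟ i
      ... | yes _  = refl
      ... | no i≢i = contradiction ≡.refl i≢i
      eᵢ : ∀ l → A i l ≈ a * B′ i l + B i l
      eᵢ l = trans (e l) (+-congʳ (*-congˡ (B′ᵢ l)))
      A≋B′ : ∀ p → p ≢ i → A p ≋ B′ p
      A≋B′ p p≢i l with p ≟ i
      ... | yes p≡i = contradiction p≡i p≢i
      ... | no _    = A≋B p p≢i l

  -- One swap brings `A zero` back to the top and costs a sign; the induction then works below it,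
  -- in the form with that row fixed.
  rotate : ∀ {k n} {f : (Fin (ℕ.suc k) → Row n) → Carrier} → IsAlternating f →
           ∀ j A → f (A j ∷ A ∘ punchIn j) ≈ (- 1#) ^ toℕ j * f A
  rotate alt zero A =
    trans (IsAlternating.cong-rows alt (∷-cong (λ _ → refl) (λ _ _ → refl))) (sym (*-identityˡ _))
  rotate {ℕ.suc k} {n} {f} alt (suc j) A = begin
    f (A (suc j) ∷ A ∘ punchIn (suc j))
      ≈⟨ +-inverseˡ-unique _ _ (antisymmetric alt {zero} {suc zero} (λ ())
           (λ _ → refl) (λ _ → refl)
           λ { zero 0≢0 _ → contradiction ≡.refl 0≢0
             ; (suc zero) _ 1≢1 → contradiction ≡.refl 1≢1
             ; (suc (suc _)) _ _ _ → refl }) ⟩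
    - f (A zero ∷ (A (suc j) ∷ A ∘ suc ∘ punchIn j))
      ≈⟨ -‿cong (rotate (fix-row alt (A zero)) j (A ∘ suc)) ⟩
    - ((- 1#) ^ toℕ j * f (A zero ∷ A ∘ suc))
      ≈⟨ -1*x≈-x _ ⟨
    - 1# * ((- 1#) ^ toℕ j * f (A zero ∷ A ∘ suc))
      ≈⟨ *-assoc _ _ _ ⟨
    (- 1#) ^ toℕ (suc j) * f (A zero ∷ A ∘ suc)
      ≈⟨ *-congˡ (IsAlternating.cong-rows alt (∷-cong (λ _ → refl) (λ _ _ → refl))) ⟩
    (- 1#) ^ toℕ (suc j) * f A ∎

  split-at : ∀ {n} (j : Fin (ℕ.suc n)) {u v : Row (ℕ.suc n)} →
             u j ≈ v j → u ∘ punchIn j ≋ v ∘ punchIn j → u ≋ v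
  split-at j {u} {v} e es l with j ≟ l
  ... | yes ≡.refl = e
  ... | no j≢l     = ≡.subst (λ l → u l ≈ v l) (punchIn-punchOut j≢l) (es (punchOut j≢l))

  I-diag : ∀ {n} (j : Fin n) → I j j ≡ 1#
  I-diag zero    = ≡.refl
  I-diag (suc j) = I-diag j

  I-off : ∀ {n} {j l : Fin n} → j ≢ l → I j l ≡ 0#
  I-off {j = j} {l} j≢l with j ≟ l
  ... | yes j≡l = contradiction j≡l j≢l
  ... | no _    = ≡.refl

  I-punchIn : ∀ {n} (j : Fin (ℕ.suc n)) k l → I (punchIn j k) (punchIn j l) ≡ I k l
  I-punchIn zero    k       l       = ≡.refl
  I-punchIn (suc j) zero    zero    = ≡.refl
  I-punchIn (suc j) zero    (suc l) = ≡.refl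
  I-punchIn (suc j) (suc k) zero    = ≡.refl
  I-punchIn (suc j) (suc k) (suc l) = I-punchIn j k l

  -- Linearity in the first row reduces it to the unit rows `I j`. Multiples of `I j` clear column
  -- `j` below it, and what is left is an alternating form of the minor, to which the induction
  -- applies; its value at the smaller identity is `f I` up to the Laplace sign.
  alternating-det : ∀ {n} {f : Matrix n → Carrier} → IsAlternating f → ∀ A → f A ≈ det A * f I
  alternating-det {ℕ.zero}  alt A = trans (IsAlternating.cong-rows alt λ ()) (sym (*-identityˡ _))
  alternating-det {ℕ.suc n} {f} alt A = begin
    f A
      ≈⟨ cong-rows (∷-cong (λ _ → refl) (λ _ _ → refl)) ⟩
    f (A zero ∷ A ∘ suc)
      ≈⟨ functional-expansion (λ u → f (u ∷ A ∘ suc))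
           (λ e → cong-rows (∷-cong e (λ _ _ → refl)))
           (λ a u v → linear zero a (λ _ → refl) (λ { zero 0≢0 → contradiction ≡.refl 0≢0 ; (suc _) _ _ → refl })
              (λ { zero 0≢0 → contradiction ≡.refl 0≢0 ; (suc _) _ _ → refl }))
           (A zero) ⟩
    sum (λ j → A zero j * f (I j ∷ A ∘ suc))
      ≈⟨ sum-cong-≋ (λ j → *-congˡ {A zero j} (column j)) ⟩
    sum (λ j → A zero j * (det (minor j A) * ((- 1#) ^ toℕ j * f I)))
      ≈⟨ sum-cong-≋ (λ j → solve 4 (λ a d s x → a :* (d :* (s :* x)) := s :* a :* d :* x) refl
           (A zero j) (det (minor j A)) ((- 1#) ^ toℕ j) (f I)) ⟩
    sum (λ j → (- 1#) ^ toℕ j * A zero j * det (minor j A) * f I)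
      ≈⟨ *-distribʳ-sum (f I) (λ j → (- 1#) ^ toℕ j * A zero j * det (minor j A)) ⟨
    det A * f I ∎
    where
    open IsAlternating alt

    module _ (j : Fin (ℕ.suc n)) where
      pad : Row n → Row (ℕ.suc n)
      pad u = insertAt u j 0#

      pad-j : ∀ u → pad u j ≈ 0#
      pad-j u = reflexive (insertAt-lookup u j 0#)

      pad-punchIn : ∀ u l → pad u (punchIn j l) ≈ u l
      pad-punchIn u l = reflexive (insertAt-punchIn u j 0# l)

      pad-cong : ∀ {u v} → u ≋ v → pad u ≋ pad v
      pad-cong {u} {v} e = split-at j
        (trans (pad-j u) (sym (pad-j v)))
        (λ l → trans (pad-punchIn u l) (trans (e l) (sym (pad-punchIn v l))))

      pad-linear : ∀ {a u v w} → (∀ l → u l ≈ a * v l + w l) →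
                   ∀ l → pad u l ≈ a * pad v l + pad w l
      pad-linear {a} {u} {v} {w} e = split-at j
        (trans (pad-j u) (sym (trans (+-cong (trans (*-congˡ (pad-j v)) (zeroʳ a)) (pad-j w)) (+-identityˡ 0#))))
        (λ l → trans (pad-punchIn u l) (trans (e l)
          (sym (+-cong (*-congˡ (pad-punchIn v l)) (pad-punchIn w l)))))

      padded : IsAlternating (λ (B : Matrix n) → f (I j ∷ pad ∘ B))
      padded = record
        { cong-rows   = λ e → IsAlternating.cong-rows (fix-row alt (I j)) (λ p → pad-cong (e p))
        ; linear      = λ i a e b c → IsAlternating.linear (fix-row alt (I j)) i a (pad-linear e)
            (λ p p≢i → pad-cong (b p p≢i)) (λ p p≢i → pad-cong (c p p≢i))
        ; alternating = λ i≢i′ e → IsAlternating.alternating (fix-row alt (I j)) i≢i′ (pad-cong e)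
        }

      column : f (I j ∷ A ∘ suc) ≈ det (minor j A) * ((- 1#) ^ toℕ j * f I)
      column = begin
        f (I j ∷ A ∘ suc)
          -- The multiple is the entry of row `suc i` in column `j`, so that removing it leaves the
          -- padding value 0 there.
          ≈⟨ add-first-row alt (I j) (λ i → A (suc i) j , split-at j
               (sym (trans (+-cong (trans (*-congˡ (reflexive (I-diag j))) (*-identityʳ _)) (pad-j (minor j A i)))
                 (+-identityʳ _)))
               (λ l → sym (trans (+-cong
                 (trans (*-congˡ (reflexive (I-off (punchInᵢ≢i j l ∘ ≡.sym)))) (zeroʳ _))
                 (pad-punchIn (minor j A i) l)) (+-identityˡ _)))) ⟩
        f (I j ∷ pad ∘ minor j A)
          ≈⟨ alternating-det padded (minor j A) ⟩
        det (minor j A) * f (I j ∷ pad ∘ I)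
          -- The padded rows of the smaller identity are the rows of `I` other than row `j`, which
          -- here stands on top.
          ≈⟨ *-congˡ (cong-rows (∷-cong (λ _ → refl) λ p → split-at j
               (trans (pad-j (I p)) (reflexive (≡.sym (I-off (punchInᵢ≢i j p)))))
               (λ l → trans (pad-punchIn (I p) l) (reflexive (≡.sym (I-punchIn j p l)))))) ⟩
        det (minor j A) * f (I j ∷ I ∘ punchIn j)
          ≈⟨ *-congˡ (rotate alt j I) ⟩
        det (minor j A) * ((- 1#) ^ toℕ j * f I) ∎

  -- Matrix products.

  infixl 7 _·_
  _·_ : ∀ {n} → Matrix n → Matrix n → Matrix n
  (A · B) i l = sum λ k → A i k * B k l

  functional-I : ∀ {n} i (u : Row n) → sum (λ k → I i k * u k) ≈ u i
  functional-I zero u = trans (+-cong (*-identityˡ _) (sum-zero λ k → zeroˡ (u (suc k)))) (+-identityʳ _)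
  functional-I (suc i) u = trans (+-cong (zeroˡ _) (functional-I i (u ∘ suc))) (+-identityˡ _)

  -- As a function of the rows of `A`, `det (A · B)` is alternating, hence `det A` times its value
  -- at `A = I`, which is `det B`.
  det-· : ∀ {n} (A B : Matrix n) → det (A · B) ≈ det A * det B
  det-· {n} A B = trans (alternating-det alt A)
    (*-congˡ {det A} (det-cong λ p l → functional-I p (λ k → B k l)))
    where
    open IsAlternating (det-isAlternating n)
    alt : IsAlternating (λ A → det (A · B))
    alt = record
      { cong-rows   = λ e → cong-rows λ p l → sum-cong-≋ λ k → *-congʳ {B k l} (e p k)
      ; linear      = λ i a {A} {B′} {C} e b c → linear i a
          (λ l → sum-linear a {λ k → A i k * B k l} {λ k → B′ i k * B k l} {λ k → C i k * B k l} λ k →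
            trans (*-congʳ (e k))
              (solve 4 (λ a x y z → (a :* x :+ y) :* z := a :* (x :* z) :+ y :* z) refl a (B′ i k) (C i k) (B k l)))
          (λ p p≢i l → sum-cong-≋ λ k → *-congʳ {B k l} (b p p≢i k))
          (λ p p≢i l → sum-cong-≋ λ k → *-congʳ {B k l} (c p p≢i k))
      ; alternating = λ i≢j e → alternating i≢j λ l → sum-cong-≋ λ k → *-congʳ {B k l} (e k)
      }

  det-I : ∀ n → det (I {n}) ≈ 1#
  det-I ℕ.zero    = refl
  det-I (ℕ.suc n) = begin
    1# * 1# * det (I {n}) + sum (λ (j : Fin n) → (- 1#) ^ toℕ (suc j) * 0# * det (minor (suc j) I))
      ≈⟨ +-cong (*-cong (*-identityˡ 1#) (det-I n))
           (sum-zero λ (j : Fin n) → trans (*-congʳ (zeroʳ ((- 1#) ^ toℕ (suc j)))) (zeroˡ (det (minor (suc j) I)))) ⟩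
    1# * 1# + 0#
      ≈⟨ trans (+-identityʳ _) (*-identityˡ 1#) ⟩
    1# ∎

-- Index arithmetic and adjacency blocks

open import Data.List.Base using ([]; _∷_; _++_)
open import Data.List.Membership.Propositional using (_∈_)
open import Data.List.Relation.Unary.All as All using (All; []; _∷_)
open import Data.List.Relation.Unary.Any using (here; there)

toℕ-⊕ : ∀ {m} .{{_ : NonZero m}} (i : Fin m) k → toℕ (i ⊕ k) ≡ (toℕ i ℕ.+ k) % m
toℕ-⊕ i k = toℕ-fromℕ< _

⊕-unique : ∀ {m} (i j : Fin (ℕ.suc m)) k → (toℕ i ℕ.+ k) % ℕ.suc m ≡ toℕ j → i ⊕ k ≡ j
⊕-unique i j k e = toℕ-injective (≡.trans (toℕ-⊕ i k) e)

⊕-⊕ : ∀ {m} (i : Fin m) k l → (i ⊕ k) ⊕ l ≡ i ⊕ (k ℕ.+ l)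
⊕-⊕ {m@(ℕ.suc _)} i k l = ⊕-unique (i ⊕ k) (i ⊕ (k ℕ.+ l)) l (begin
  (toℕ (i ⊕ k) ℕ.+ l) % m          ≡⟨ ≡.cong (λ t → (t ℕ.+ l) % m) (toℕ-⊕ i k) ⟩
  ((a ℕ.+ k) % m ℕ.+ l) % m        ≡⟨ %-distribˡ-+ ((a ℕ.+ k) % m) l m ⟩
  ((a ℕ.+ k) % m % m ℕ.+ l % m) % m ≡⟨ ≡.cong (λ t → (t ℕ.+ l % m) % m) (m%n%n≡m%n (a ℕ.+ k) m) ⟩
  ((a ℕ.+ k) % m ℕ.+ l % m) % m    ≡⟨ %-distribˡ-+ (a ℕ.+ k) l m ⟨
  (a ℕ.+ k ℕ.+ l) % m              ≡⟨ ≡.cong (_% m) (ℕ.+-assoc a k l) ⟩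
  (a ℕ.+ (k ℕ.+ l)) % m            ≡⟨ toℕ-⊕ i (k ℕ.+ l) ⟨
  toℕ (i ⊕ (k ℕ.+ l))              ∎)
  where
  open ≡.≡-Reasoning
  a = toℕ i

⊕-period : ∀ {m} (i : Fin m) → i ⊕ m ≡ i
⊕-period {m@(ℕ.suc _)} i =
  ⊕-unique i i m (≡.trans ([m+n]%n≡m%n (toℕ i) m) (m<n⇒m%n≡m (toℕ<n i)))

-- The modulus is `suc m` after matching, so adding `m` completes the period and undoes the shift.
⊕1-injective : ∀ {m} {i j : Fin m} → i ⊕ 1 ≡ j ⊕ 1 → i ≡ j
⊕1-injective {ℕ.suc m} {i} {j} e = begin
  i               ≡⟨ ⊕-period i ⟨
  i ⊕ ℕ.suc m     ≡⟨ ⊕-⊕ i 1 m ⟨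
  (i ⊕ 1) ⊕ m     ≡⟨ ≡.cong (_⊕ m) e ⟩
  (j ⊕ 1) ⊕ m     ≡⟨ ⊕-⊕ j 1 m ⟩
  j ⊕ ℕ.suc m     ≡⟨ ⊕-period j ⟩
  j               ∎
  where open ≡.≡-Reasoning

⊕-≢ : ∀ {m} (i : Fin m) k → 0 ℕ.< k → k ℕ.< m → i ≢ i ⊕ k
⊕-≢ {m@(ℕ.suc _)} i k 0<k k<m e with toℕ i ℕ.+ k ℕ.<? m
... | yes a+k<m = ℕ.<⇒≢ (ℕ.m<m+n (toℕ i) 0<k)
  (≡.trans (≡.cong toℕ e) (≡.trans (toℕ-⊕ i k) (m<n⇒m%n≡m a+k<m)))
... | no a+k≮m = ℕ.<⇒≢ r<a (≡.sym (≡.trans (≡.cong toℕ e) (≡.trans (toℕ-⊕ i k) r%)))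
  where
  r = toℕ i ℕ.+ k ℕ.∸ m
  r+m : r ℕ.+ m ≡ toℕ i ℕ.+ k
  r+m = ℕ.m∸n+n≡m (ℕ.≮⇒≥ a+k≮m)
  r<a : r ℕ.< toℕ i
  r<a = ℕ.+-cancelʳ-< m r (toℕ i) (≡.subst (ℕ._< toℕ i ℕ.+ m) (≡.sym r+m) (ℕ.+-monoʳ-< (toℕ i) k<m))
  r% : (toℕ i ℕ.+ k) % m ≡ r
  r% = ≡.trans (≡.cong (_% m) (≡.sym r+m))
    (≡.trans ([m+n]%n≡m%n r m) (m<n⇒m%n≡m (ℕ.<-trans r<a (toℕ<n i))))

difference : ∀ {m} {i j : Fin m} → i ≢ j → ∃[ k ] 0 ℕ.< k × k ℕ.< m × i ⊕ k ≡ j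
difference {m@(ℕ.suc _)} {i} {j} i≢j with ℕ.<-cmp (toℕ i) (toℕ j)
... | tri< a<b _ _ = toℕ j ℕ.∸ toℕ i , ℕ.m<n⇒0<n∸m a<b , ℕ.≤-<-trans (ℕ.m∸n≤m (toℕ j) (toℕ i)) (toℕ<n j) ,
  ⊕-unique i j _ (≡.trans (≡.cong (_% m) (ℕ.m+[n∸m]≡n (ℕ.<⇒≤ a<b))) (m<n⇒m%n≡m (toℕ<n j)))
... | tri≈ _ a≡b _ = contradiction (toℕ-injective a≡b) i≢j
... | tri> _ _ b<a = toℕ j ℕ.+ (m ℕ.∸ toℕ i) ,
  ℕ.<-≤-trans (ℕ.m<n⇒0<n∸m (toℕ<n i)) (ℕ.m≤n+m _ _) ,
  ≡.subst (toℕ j ℕ.+ (m ℕ.∸ toℕ i) ℕ.<_) a+[m∸a] (ℕ.+-monoˡ-< _ b<a) ,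
  ⊕-unique i j _ (begin
    (toℕ i ℕ.+ (toℕ j ℕ.+ (m ℕ.∸ toℕ i))) % m ≡⟨ ≡.cong (_% m) (x∙yz≈y∙xz (toℕ i) (toℕ j) _) ⟩
    (toℕ j ℕ.+ (toℕ i ℕ.+ (m ℕ.∸ toℕ i))) % m ≡⟨ ≡.cong (λ t → (toℕ j ℕ.+ t) % m) a+[m∸a] ⟩
    (toℕ j ℕ.+ m) % m                         ≡⟨ [m+n]%n≡m%n (toℕ j) m ⟩
    toℕ j % m                                 ≡⟨ m<n⇒m%n≡m (toℕ<n j) ⟩
    toℕ j                                     ∎)
  where
  open ≡.≡-Reasoning
  open import Algebra.Properties.CommutativeSemigroup ℕ.+-commutativeSemigroup using (x∙yz≈y∙xz)
  a+[m∸a] : toℕ i ℕ.+ (m ℕ.∸ toℕ i) ≡ m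
  a+[m∸a] = ℕ.m+[n∸m]≡n (ℕ.<⇒≤ (toℕ<n i))

⌊n/2⌋<n : ∀ {n} → 0 ℕ.< n → ⌊ n /2⌋ ℕ.< n
⌊n/2⌋<n {ℕ.suc n} _ = ℕ.⌊n/2⌋<n n

-- Of two complementary differences `k` and `m ∸ k`, one is at most `⌊ m /2⌋`. This matches the
-- hypotheses on blocks, which are stated for such offsets in one direction only.
half-difference : ∀ {m} {i j : Fin m} → i ≢ j →
  ∃[ k ] 0 ℕ.< k × k ℕ.≤ ⌊ m /2⌋ × (i ⊕ k ≡ j ⊎ j ⊕ k ≡ i)
half-difference {m} {i} {j} i≢j with difference i≢j
... | k , 0<k , k<m , e with k ℕ.≤? ⌊ m /2⌋
...   | yes k≤ = k , 0<k , k≤ , inj₁ e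
...   | no k≰  = m ℕ.∸ k , ℕ.m<n⇒0<n∸m k<m , m∸k≤ , inj₂ (begin
  j ⊕ (m ℕ.∸ k)           ≡⟨ ≡.cong (_⊕ (m ℕ.∸ k)) e ⟨
  (i ⊕ k) ⊕ (m ℕ.∸ k)     ≡⟨ ⊕-⊕ i k (m ℕ.∸ k) ⟩
  i ⊕ (k ℕ.+ (m ℕ.∸ k))   ≡⟨ ≡.cong (i ⊕_) (ℕ.m+[n∸m]≡n (ℕ.<⇒≤ k<m)) ⟩
  i ⊕ m                   ≡⟨ ⊕-period i ⟩
  i                       ∎)
  where
  open ≡.≡-Reasoning
  -- From `k > ⌊ m /2⌋` follows `k ≥ ⌈ m /2⌉`, since `⌈ m /2⌉` is `⌊ suc m /2⌋` and so at most
  -- `suc ⌊ m /2⌋`.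
  m∸k≤ : m ℕ.∸ k ℕ.≤ ⌊ m /2⌋
  m∸k≤ = ℕ.≤-trans
    (ℕ.∸-monoʳ-≤ m (ℕ.≤-trans (ℕ.⌊n/2⌋-mono (ℕ.n≤1+n (ℕ.suc m))) (ℕ.≰⇒> k≰)))
    (ℕ.≤-reflexive (≡.trans (≡.cong (ℕ._∸ ⌈ m /2⌉) (≡.sym (ℕ.⌊n/2⌋+⌈n/2⌉≡n m)))
      (ℕ.m+n∸n≡m ⌊ m /2⌋ ⌈ m /2⌉)))

-- Blocks of the adjacency matrix between two of the sets Cᵢ.

Block : Set
Block = Fin 2 → Fin 2 → Bool

IsRow IsColumn RowIndependent ColumnIndependent : Block → Set
IsRow X             = ∃[ p ] (∀ a b → X a b ≡ does (a ≟ p))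
IsColumn X          = ∃[ q ] (∀ a b → X a b ≡ does (b ≟ q))
RowIndependent X    = ∀ a a′ b → X a b ≡ X a′ b
ColumnIndependent X = ∀ a b b′ → X a b ≡ X a b′

row⇒columnIndependent : ∀ {X} → IsRow X → ColumnIndependent X
row⇒columnIndependent (p , e) a b b′ = ≡.trans (e a b) (≡.sym (e a b′))

column⇒rowIndependent : ∀ {X} → IsColumn X → RowIndependent X
column⇒rowIndependent (q , e) a a′ b = ≡.trans (e a b) (≡.sym (e a′ b))

T-ext : ∀ {x y} → (T x → T y) → (T y → T x) → x ≡ y
T-ext {false} {false} f g = ≡.refl
T-ext {false} {true}  f g = ⊥-elim (g _)
T-ext {true}  {false} f g = ⊥-elim (f _)
T-ext {true}  {true}  f g = ≡.refl

-- The blocks of the old graph at (i, j), (i, j + 1) and (i + 1, j), and the block of the new graph at (i, j).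
data Shape (X Y Z R : Block) : Set where
  new≡X : RowIndependent X → ColumnIndependent X → ColumnIndependent Y → RowIndependent Z →
          (∀ a b → R a b ≡ X a b) → Shape X Y Z R
  new≡Y : IsRow X ⊎ IsColumn X → IsColumn Y → RowIndependent Z →
          (∀ a b → R a b ≡ Y a b) → Shape X Y Z R
  new≡Z : IsRow X ⊎ IsColumn X → ColumnIndependent Y → IsRow Z →
          (∀ a b → R a b ≡ Z a b) → Shape X Y Z R

bit : Bool → ℕ
bit b = if b then 1 else 0

module Blocks {n m : ℕ} (m≥5 : m ≥ 5) (Γ : Graph n) (P : Partition n m) (S : Switchable Γ P) where
  open Graph Γ
  open Partition P
  open Switchable S

  k<m : ∀ k {_ : T (k ℕ.<ᵇ 5)} → k ℕ.< m
  k<m k {k<5} = ℕ.<-≤-trans (ℕ.<ᵇ⇒< k 5 k<5) m≥5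

  i≢i⊕ : ∀ i k {_ : T (0 ℕ.<ᵇ k)} {_ : T (k ℕ.<ᵇ 5)} → i ≢ i ⊕ k
  i≢i⊕ i k {0<k} {k<5} = ⊕-≢ i k (ℕ.<ᵇ⇒< 0 k 0<k) (k<m k {k<5})

  i≢i⊕half : ∀ i k → 3 ℕ.≤ k → k ℕ.≤ ⌊ m /2⌋ → i ≢ i ⊕ k
  i≢i⊕half i k 3≤k k≤m/2 = ⊕-≢ i k (ℕ.<-≤-trans (ℕ.s≤s ℕ.z≤n) 3≤k) (ℕ.≤-<-trans k≤m/2 (⌊n/2⌋<n (k<m 0)))

  block : Fin m → Fin m → Block
  block i j a b = adj (v i a) (v j b)

  v-injective : ∀ {i j a b} → v i a ≡ v j b → i ≡ j × a ≡ b
  v-injective {i} {j} {a} {b} e = ,-injective (inj₁-injective (begin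
    inj₁ (i , a)              ≡⟨ Inverse.strictlyInverseˡ labelling _ ⟨
    label (v i a)             ≡⟨ ≡.cong label e ⟩
    label (v j b)             ≡⟨ Inverse.strictlyInverseˡ labelling _ ⟩
    inj₁ (j , b)              ∎))
    where open ≡.≡-Reasoning

  ∈-C++ˡ : ∀ i j a → v i a ∈ C i ++ C j
  ∈-C++ˡ i j 0F = here ≡.refl
  ∈-C++ˡ i j 1F = there (here ≡.refl)

  ∈-C++ʳ : ∀ i j b → v j b ∈ C i ++ C j
  ∈-C++ʳ i j 0F = there (there (here ≡.refl))
  ∈-C++ʳ i j 1F = there (there (there (here ≡.refl)))

  -- `InducedEdgeSet` admits either orientation of a listed edge. All listed pairs run from `C i` to
  -- `C j`, so for `i ≢ j` the reverse orientation cannot occur.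
  induced-block : ∀ {i j E} → i ≢ j → (X : Block) → InducedEdgeSet Γ P (C i ++ C j) E →
    (∀ a b → T (X a b) → (v i a , v j b) ∈ E) →
    All (λ e → ∃[ a ] ∃[ b ] T (X a b) × e ≡ (v i a , v j b)) E →
    ∀ a b → block i j a b ≡ X a b
  induced-block {i} {j} {E} i≢j X induced X⇒E E⇒X a b = T-ext
    ([ (λ e → forwards (All.lookup E⇒X e)) , (λ e → backwards (All.lookup E⇒X e)) ]′ ∘ Equivalence.to eq)
    (Equivalence.from eq ∘ inj₁ ∘ X⇒E a b)
    where
    eq = induced (∈-C++ˡ i j a) (∈-C++ʳ i j b)
    forwards : ∃[ c ] ∃[ d ] T (X c d) × (v i a , v j b) ≡ (v i c , v j d) → T (X a b)
    forwards (c , d , t , e) with ,-injective e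
    ... | e₁ , e₂ with v-injective e₁ | v-injective e₂
    ...   | _ , ≡.refl | _ , ≡.refl = t
    backwards : ∃[ c ] ∃[ d ] T (X c d) × (v j b , v i a) ≡ (v i c , v j d) → T (X a b)
    backwards (c , d , t , e) = contradiction (≡.sym (proj₁ (v-injective (proj₁ (,-injective e))))) i≢j

  -- The edge list describes the whole induced subgraph, including the inside of `C i`. This is how
  -- the sets Cᵢ are seen to be edgeless, which `Switchable` does not state separately.
  no-inner-edges : ∀ {i j E} → i ≢ j → InducedEdgeSet Γ P (C i ++ C j) E →
    All (λ e → ∃[ a ] ∃[ b ] e ≡ (v i a , v j b)) E → ∀ a b → block i i a b ≡ false
  no-inner-edges {i} {j} {E} i≢j induced crossing a b = T-ext
    ([ absurd , absurd ]′ ∘ Equivalence.to (induced (∈-C++ˡ i j a) (∈-C++ˡ i j b)))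
    λ ()
    where
    absurd : ∀ {a b} → (v i a , v i b) ∈ E → T false
    absurd e∈E with All.lookup crossing e∈E
    ... | _ , _ , e = contradiction (proj₁ (v-injective (proj₂ (,-injective e)))) i≢j

  transpose-row : ∀ {i j} → IsRow (block i j) → IsColumn (block j i)
  transpose-row (p , e) = p , λ a b → ≡.trans (symm _ _) (e b a)

  transpose-column : ∀ {i j} → IsColumn (block i j) → IsRow (block j i)
  transpose-column (q , e) = q , λ a b → ≡.trans (symm _ _) (e b a)

  block-1 : ∀ i → IsRow (block i (i ⊕ 1))
  block-1 i with offset1 i
  ... | inj₁ e = 0F , induced-block (i≢i⊕ i 1) (λ a b → does (a ≟ 0F)) e
    (λ { 0F 0F _ → here ≡.refl ; 0F 1F _ → there (here ≡.refl) })
    ((0F , 0F , _ , ≡.refl) ∷ (0F , 1F , _ , ≡.refl) ∷ [])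
  ... | inj₂ e = 1F , induced-block (i≢i⊕ i 1) (λ a b → does (a ≟ 1F)) e
    (λ { 1F 0F _ → here ≡.refl ; 1F 1F _ → there (here ≡.refl) })
    ((1F , 0F , _ , ≡.refl) ∷ (1F , 1F , _ , ≡.refl) ∷ [])

  block-2 : ∀ i → IsColumn (block i (i ⊕ 2))
  block-2 i with offset2 i
  ... | inj₁ e = 0F , induced-block (i≢i⊕ i 2) (λ a b → does (b ≟ 0F)) e
    (λ { 0F 0F _ → here ≡.refl ; 1F 0F _ → there (here ≡.refl) })
    ((0F , 0F , _ , ≡.refl) ∷ (1F , 0F , _ , ≡.refl) ∷ [])
  ... | inj₂ e = 1F , induced-block (i≢i⊕ i 2) (λ a b → does (b ≟ 1F)) e
    (λ { 0F 1F _ → here ≡.refl ; 1F 1F _ → there (here ≡.refl) })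
    ((0F , 1F , _ , ≡.refl) ∷ (1F , 1F , _ , ≡.refl) ∷ [])

  block-≥3 : ∀ i k → 3 ℕ.≤ k → k ℕ.≤ ⌊ m /2⌋ → ∃[ c ] (∀ a b → block i (i ⊕ k) a b ≡ c)
  block-≥3 i k 3≤k k≤m/2 with offset≥3 i k 3≤k k≤m/2
  ... | inj₁ e = false , induced-block (i≢i⊕half i k 3≤k k≤m/2) (λ _ _ → false) e (λ _ _ ()) []
  ... | inj₂ e = true , induced-block (i≢i⊕half i k 3≤k k≤m/2) (λ _ _ → true) e
    (λ { 0F 0F _ → here ≡.refl ; 0F 1F _ → there (here ≡.refl)
       ; 1F 0F _ → there (there (here ≡.refl)) ; 1F 1F _ → there (there (there (here ≡.refl))) })
    ((0F , 0F , _ , ≡.refl) ∷ (0F , 1F , _ , ≡.refl) ∷ (1F , 0F , _ , ≡.refl) ∷ (1F , 1F , _ , ≡.refl) ∷ [])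

  block-0 : ∀ i a b → block i i a b ≡ false
  block-0 i a b with offset1 i
  ... | inj₁ e = no-inner-edges (i≢i⊕ i 1) e ((_ , _ , ≡.refl) ∷ (_ , _ , ≡.refl) ∷ []) a b
  ... | inj₂ e = no-inner-edges (i≢i⊕ i 1) e ((_ , _ , ≡.refl) ∷ (_ , _ , ≡.refl) ∷ []) a b

  -- The excluded offsets 2 and -1 are those with a column block. Offset 1 gives a row block, offset
  -- -2 the transpose of a column block, and all other offsets a constant block.
  columnIndependent : ∀ i j → j ≢ i ⊕ 2 → i ≢ j ⊕ 1 → ColumnIndependent (block i j)
  columnIndependent i j j≢i⊕2 i≢j⊕1 a b b′ with i ≟ j
  ... | yes ≡.refl = ≡.trans (block-0 i a b) (≡.sym (block-0 i a b′))
  ... | no i≢j with half-difference i≢j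
  ...   | 1 , _ , _ , inj₁ ≡.refl = row⇒columnIndependent (block-1 i) a b b′
  ...   | 1 , _ , _ , inj₂ e      = contradiction (≡.sym e) i≢j⊕1
  ...   | 2 , _ , _ , inj₁ e      = contradiction (≡.sym e) j≢i⊕2
  ...   | 2 , _ , _ , inj₂ ≡.refl = begin
    block i j a b  ≡⟨ symm (v i a) (v j b) ⟩
    block j i b a  ≡⟨ column⇒rowIndependent (block-2 j) b b′ a ⟩
    block j i b′ a ≡⟨ symm (v j b′) (v i a) ⟩
    block i j a b′ ∎
    where open ≡.≡-Reasoning
  ...   | k@(ℕ.suc (ℕ.suc (ℕ.suc _))) , _ , k≤m/2 , inj₁ ≡.refl =
    ≡.trans (proj₂ c a b) (≡.sym (proj₂ c a b′))
    where c = block-≥3 i k (ℕ.s≤s (ℕ.s≤s (ℕ.s≤s ℕ.z≤n))) k≤m/2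
  ...   | k@(ℕ.suc (ℕ.suc (ℕ.suc _))) , _ , k≤m/2 , inj₂ ≡.refl = begin
    block i j a b  ≡⟨ symm (v i a) (v j b) ⟩
    block j i b a  ≡⟨ proj₂ c b a ⟩
    proj₁ c        ≡⟨ proj₂ c b′ a ⟨
    block j i b′ a ≡⟨ symm (v j b′) (v i a) ⟩
    block i j a b′ ∎
    where
    open ≡.≡-Reasoning
    c = block-≥3 j k (ℕ.s≤s (ℕ.s≤s (ℕ.s≤s ℕ.z≤n))) k≤m/2

  rowIndependent : ∀ i j → j ≢ i ⊕ 1 → i ≢ j ⊕ 2 → RowIndependent (block i j)
  rowIndependent i j j≢i⊕1 i≢j⊕2 a a′ b = begin
    block i j a b  ≡⟨ symm (v i a) (v j b) ⟩
    block j i b a  ≡⟨ columnIndependent j i i≢j⊕2 j≢i⊕1 b a a′ ⟩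
    block j i b a′ ≡⟨ symm (v j b) (v i a′) ⟩
    block i j a′ b ∎
    where open ≡.≡-Reasoning

  -- At the two offsets excluded from `columnIndependent` the block is a column block, hence
  -- independent of its row. This makes every double deviation vanish.
  independent : ∀ i j → RowIndependent (block i j) ⊎ ColumnIndependent (block i j)
  independent i j with j ≟ i ⊕ 2 | i ≟ j ⊕ 1
  ... | yes ≡.refl | _          = inj₁ (column⇒rowIndependent (block-2 i))
  ... | no j≢      | no i≢      = inj₂ (columnIndependent i j j≢ i≢)
  ... | no _       | yes ≡.refl = inj₁ λ a a′ b →
    ≡.trans (symm _ _) (≡.trans (row⇒columnIndependent (block-1 j) b a a′) (symm _ _))

  ⊕1-⊕1 : ∀ (i : Fin m) → i ⊕ 1 ⊕ 1 ≡ i ⊕ 2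
  ⊕1-⊕1 i = ⊕-⊕ i 1 1

  -- The cases are those of `switchC`, and in each the replacement is a neighbour of block (i, j) in
  -- the block matrix: at offsets 1 and -2 it is the block (i, j + 1), at offsets -1 and 2 the block
  -- (i + 1, j).
  shape : ∀ i j → Shape (block i j) (block i (j ⊕ 1)) (block (i ⊕ 1) j) (λ a b → switchC Γ P i a j b)
  shape i j with j ≟ i ⊕ 1
  ... | yes ≡.refl = new≡Y (inj₁ (block-1 i))
    (≡.subst (IsColumn ∘ block i) (≡.sym (⊕1-⊕1 i)) (block-2 i))
    (rowIndependent j j (i≢i⊕ j 1) (i≢i⊕ j 2))
    (λ a b → ≡.cong (λ l → block i l a b) (≡.sym (⊕1-⊕1 i)))
  ... | no j≢i⊕1 with i ≟ j ⊕ 1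
  ...   | yes ≡.refl = new≡Z (inj₂ (transpose-row (block-1 j)))
    (columnIndependent i i (i≢i⊕ i 2) (i≢i⊕ i 1))
    (≡.subst (λ l → IsRow (block l j)) (≡.sym (⊕1-⊕1 j)) (transpose-column (block-2 j)))
    (λ a b → ≡.trans (symm _ _) (≡.cong (λ l → block l j a b) (≡.sym (⊕1-⊕1 j))))
  ...   | no i≢j⊕1 with j ≟ i ⊕ 2
  ...     | yes ≡.refl = new≡Z (inj₂ (block-2 i))
    -- This block has offset 3, which must differ from 2 and from -1 modulo `m`; the latter amounts
    -- to `i ≢ i ⊕ 4` and would fail for `m = 4`.
    (columnIndependent i (j ⊕ 1)
      (λ e → i≢i⊕ (i ⊕ 2) 1 (≡.sym e))
      (λ e → i≢i⊕ i 4 (≡.trans e (≡.trans (⊕1-⊕1 j) (⊕-⊕ i 2 2)))))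
    (≡.subst (IsRow ∘ block (i ⊕ 1)) (⊕1-⊕1 i) (block-1 (i ⊕ 1)))
    (λ a b → ≡.refl)
  ...     | no j≢i⊕2 with i ≟ j ⊕ 2
  ...       | yes ≡.refl = new≡Y (inj₁ (transpose-column (block-2 j)))
    (transpose-row (≡.subst (IsRow ∘ block (j ⊕ 1)) (⊕1-⊕1 j) (block-1 (j ⊕ 1))))
    (rowIndependent (i ⊕ 1) j
      (λ e → i≢i⊕ j 4 (≡.trans e (≡.trans (⊕1-⊕1 i) (⊕-⊕ j 2 2))))
      (λ e → i≢i⊕ (j ⊕ 2) 1 (≡.sym e)))
    (λ a b → symm _ _)
  ...       | no i≢j⊕2 = new≡X
    (rowIndependent i j j≢i⊕1 i≢j⊕2)
    (columnIndependent i j j≢i⊕2 i≢j⊕1)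
    (columnIndependent i (j ⊕ 1)
      (λ e → j≢i⊕1 (⊕1-injective (≡.trans e (≡.sym (⊕1-⊕1 i)))))
      (λ e → i≢j⊕2 (≡.trans e (⊕1-⊕1 j))))
    (rowIndependent (i ⊕ 1) j
      (λ e → j≢i⊕2 (≡.trans e (⊕1-⊕1 i)))
      (λ e → i≢j⊕1 (⊕1-injective (≡.trans e (≡.sym (⊕1-⊕1 j))))))
    (λ a b → ≡.refl)

  -- Adjacency between D and the sets Cᵢ.

  neighboursIn-C : ∀ x j → neighboursIn Γ P x j ≡ bit (adj x (v j 0F)) ℕ.+ bit (adj x (v j 1F))
  neighboursIn-C x j with adj x (v j 0F)
  ... | true  with adj x (v j 1F)
  ...   | true  = ≡.refl
  ...   | false = ≡.refl
  neighboursIn-C x j | false with adj x (v j 1F)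
  ...   | true  = ≡.refl
  ...   | false = ≡.refl

  exactly-one : ∀ x j → neighboursIn Γ P x j ≡ 1 → ∃[ p ] (∀ a → adj x (v j a) ≡ does (a ≟ p))
  exactly-one x j e with adj x (v j 0F) in e₀ | adj x (v j 1F) in e₁ | neighboursIn Γ P x j | neighboursIn-C x j
  ... | true  | false | _ | _      = 0F , λ { 0F → e₀ ; 1F → e₁ }
  ... | false | true  | _ | _      = 1F , λ { 0F → e₀ ; 1F → e₁ }
  ... | true  | true  | _ | ≡.refl = contradiction e λ ()
  ... | false | false | _ | ≡.refl = contradiction e λ ()

  not-one : ∀ x j → neighboursIn Γ P x j ≢ 1 → adj x (v j 0F) ≡ adj x (v j 1F)
  not-one x j ne with adj x (v j 0F) | adj x (v j 1F) | neighboursIn Γ P x j | neighboursIn-C x j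
  ... | true  | true  | _ | _ = ≡.refl
  ... | true  | false | _ | e = contradiction e ne
  ... | false | true  | _ | e = contradiction e ne
  ... | false | false | _ | _ = ≡.refl

  odd⇒one : ∀ x j → neighboursIn Γ P x j % 2 ≡ 1 → neighboursIn Γ P x j ≡ 1
  odd⇒one x j odd with adj x (v j 0F) | adj x (v j 1F) | neighboursIn Γ P x j | neighboursIn-C x j
  ... | true  | true  | _ | ≡.refl = contradiction odd λ ()
  ... | true  | false | _ | e      = e
  ... | false | true  | _ | e      = e
  ... | false | false | _ | ≡.refl = contradiction odd λ ()

  -- Counts in a set of two vertices are 0, 1 or 2, and only 1 is odd. Since all counts have the
  -- same parity, either every count is 1 or none is, and in the second case `x` treats both
  -- vertices of each set alike.
  D-shape : ∀ x →
    (∀ j → adj (D x) (v j 0F) ≡ adj (D x) (v j 1F)) × (∀ i a → switchD Γ P x i a ≡ adj (D x) (v i a)) ⊎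
    (∀ j → ∃[ p ] (∀ a → adj (D x) (v j a) ≡ does (a ≟ p))) ×
    (∀ i a → switchD Γ P x i a ≡ adj (D x) (v (i ⊕ 1) a))
  D-shape x = by-cases one?
    where
    one? = all? λ j → neighboursIn Γ P (D x) j ℕ.≟ 1
    switchD-if : ∀ {b} → does one? ≡ b → ∀ i a →
      switchD Γ P x i a ≡ (if b then adj (D x) (v (i ⊕ 1) a) else adj (D x) (v i a))
    switchD-if ≡.refl i a = ≡.refl
    by-cases : Dec (∀ j → neighboursIn Γ P (D x) j ≡ 1) → _
    by-cases (yes one) = inj₂ ((λ j → exactly-one (D x) j (one j)) , switchD-if (dec-true one? one))
    by-cases (no ¬one) = inj₁
      ((λ j → not-one (D x) j λ e → ¬one λ l →
         odd⇒one (D x) l (≡.trans (parity x l j) (≡.cong (_% 2) e)))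
      , switchD-if (dec-false one? ¬one))

-- Conjugation by Q

module Conjugation {c ℓ₁ ℓ₂} (ℝ : RealField c ℓ₁ ℓ₂) where
  open Spectrum ℝ
  open Determinant ℝ
  open HeytingCommutativeRing (RealField.heytingCommutativeRing ℝ) using (commutativeRing)
  open CommutativeRing commutativeRing
    hiding (zero)
  open import Algebra.Properties.Ring ring
  open import Algebra.Properties.Semiring.Sum semiring using (sum; sum-cong-≋)
  open import Relation.Binary.Reasoning.Setoid setoid
  open import Algebra.Solver.Ring.NaturalCoefficients.Default commutativeSemiring
    using (solve; _:=_; _:+_; _:*_; con)

  -- Invertibility of 2 comes from the order. Apartness of 1 and 0 gives `0# < 1#` or `1# < 0#`; the
  -- latter makes `- 1#` positive, and with it its square `1#`. Then 0 < 1 < 1 + 1, so `1# + 1#` is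
  -- apart from `0#`.
  one-half : Σ[ h ∈ Carrier ] h + h ≈ 1#
  one-half = proj₁ inv , (begin
    h + h                 ≈⟨ solve 1 (λ h → h :+ h := h :* (con 1 :+ con 1)) refl h ⟩
    h * (1# + 1#)         ≈⟨ *-congˡ (trans (+-congˡ -0#≈0#) (+-identityʳ _)) ⟨
    h * (1# + 1# - 0#)    ≈⟨ proj₁ (proj₂ inv) ⟩
    1#                    ∎)
    where
    open RealField ℝ using (_<_; _#_; isStrictPartialOrder; #⇔<⊎>; +-monoˡ-<; *-pos; #⇒invertible; invertible⇒#)
    open IsStrictPartialOrder isStrictPartialOrder using (<-resp-≈) renaming (trans to <-trans)
    <-respʳ : ∀ {x y z} → y ≈ z → x < y → x < z
    <-respʳ = proj₁ <-resp-≈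
    <-respˡ : ∀ {x y z} → y ≈ z → y < x → z < x
    <-respˡ = proj₂ <-resp-≈
    1#0 : 1# # 0#
    1#0 = invertible⇒# (1# , (trans (*-identityˡ _) 1-0 , trans (*-identityʳ _) 1-0))
      where
      1-0 : 1# - 0# ≈ 1#
      1-0 = trans (+-congˡ -0#≈0#) (+-identityʳ 1#)
    0<1 : 0# < 1#
    0<1 with Equivalence.to #⇔<⊎> 1#0
    ... | inj₂ 0<1 = 0<1
    ... | inj₁ 1<0 = <-respʳ (trans (-1*x≈-x (- 1#)) (-‿involutive 1#)) (*-pos 0<-1 0<-1)
      where
      0<-1 : 0# < - 1#
      0<-1 = <-respˡ (-‿inverseʳ 1#) (<-respʳ (+-identityˡ (- 1#)) (+-monoˡ-< (- 1#) 1<0))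
    inv = #⇒invertible (Equivalence.from #⇔<⊎> (inj₂
      (<-trans 0<1 (<-respˡ (+-identityˡ 1#) (+-monoˡ-< 1# 0<1)))))
    h = proj₁ inv

  h : Carrier
  h = proj₁ one-half

  h+h : h + h ≈ 1#
  h+h = proj₂ one-half

  -- Means and deviations on two points.

  avg : Row 2 → Carrier
  avg f = h * (f 0F + f 1F)

  dif : Row 2 → Row 2
  dif f a = h * (f a - f (opposite a))

  avg-cong : ∀ {f g} → f ≋ g → avg f ≈ avg g
  avg-cong e = *-congˡ (+-cong (e 0F) (e 1F))

  dif-cong : ∀ {f g} → f ≋ g → dif f ≋ dif g
  dif-cong e a = *-congˡ (+-cong (e a) (-‿cong (e (opposite a))))

  avg-linear : ∀ x f g → avg (λ a → x * f a + g a) ≈ x * avg f + avg g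
  avg-linear x f g = solve 6 (λ h x f₀ f₁ g₀ g₁ →
    h :* ((x :* f₀ :+ g₀) :+ (x :* f₁ :+ g₁)) := x :* (h :* (f₀ :+ f₁)) :+ h :* (g₀ :+ g₁))
    refl h x (f 0F) (f 1F) (g 0F) (g 1F)

  dif-linear : ∀ x f g a → dif (λ a → x * f a + g a) a ≈ x * dif f a + dif g a
  dif-linear x f g a = begin
    h * (x * f a + g a - (x * f a′ + g a′))
      ≈⟨ *-congˡ (+-congˡ (trans (sym (-‿+-comm _ _)) (+-congʳ (-‿distribʳ-* x (f a′))))) ⟩
    h * (x * f a + g a + (x * - f a′ + - g a′))
      ≈⟨ solve 6 (λ h x f₀ f₁ g₀ g₁ →
           h :* ((x :* f₀ :+ g₀) :+ (x :* f₁ :+ g₁)) := x :* (h :* (f₀ :+ f₁)) :+ h :* (g₀ :+ g₁))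
           refl h x (f a) (- f a′) (g a) (- g a′) ⟩
    x * dif f a + dif g a ∎
    where a′ = opposite a

  avg-const : ∀ {f} {x} → (∀ a → f a ≈ x) → avg f ≈ x
  avg-const {f} {x} e = begin
    h * (f 0F + f 1F) ≈⟨ *-congˡ (+-cong (e 0F) (e 1F)) ⟩
    h * (x + x)       ≈⟨ solve 2 (λ h x → h :* (x :+ x) := (h :+ h) :* x) refl h x ⟩
    (h + h) * x       ≈⟨ *-congʳ h+h ⟩
    1# * x            ≈⟨ *-identityˡ x ⟩
    x                 ∎

  dif-const : ∀ {f} {x} → (∀ a → f a ≈ x) → ∀ a → dif f a ≈ 0#
  dif-const {f} {x} e a = begin
    h * (f a - f (opposite a)) ≈⟨ *-congˡ (+-cong (e a) (-‿cong (e (opposite a)))) ⟩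
    h * (x - x)                ≈⟨ *-congˡ (-‿inverseʳ x) ⟩
    h * 0#                     ≈⟨ zeroʳ h ⟩
    0#                         ∎

  avg+dif : ∀ f a → avg f + dif f a ≈ f a
  avg+dif f a = begin
    avg f + dif f a
      ≈⟨ +-congʳ (*-congˡ (swap a)) ⟩
    h * (f a + f a′) + h * (f a - f a′)
      ≈⟨ solve 4 (λ h x y z → h :* (x :+ y) :+ h :* (x :+ z) := (h :+ h) :* x :+ h :* (y :+ z))
           refl h (f a) (f a′) (- f a′) ⟩
    (h + h) * f a + h * (f a′ - f a′)
      ≈⟨ +-cong (*-congʳ h+h) (trans (*-congˡ (-‿inverseʳ _)) (zeroʳ h)) ⟩
    1# * f a + 0#
      ≈⟨ trans (+-identityʳ _) (*-identityˡ _) ⟩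
    f a ∎
    where
    a′ = opposite a
    swap : ∀ a → f 0F + f 1F ≈ f a + f (opposite a)
    swap 0F = refl
    swap 1F = +-comm _ _

  avg-dif : ∀ (f : Fin 2 → Row 2) b → avg (λ a → dif (f a) b) ≈ dif (λ b → avg (λ a → f a b)) b
  avg-dif f b = begin
    h * (h * (f 0F b - f 0F b′) + h * (f 1F b - f 1F b′))
      ≈⟨ solve 5 (λ h x x′ y y′ → h :* (h :* (x :+ x′) :+ h :* (y :+ y′)) :=
           h :* (h :* (x :+ y) :+ h :* (x′ :+ y′)))
           refl h (f 0F b) (- f 0F b′) (f 1F b) (- f 1F b′) ⟩
    h * (h * (f 0F b + f 1F b) + h * (- f 0F b′ - f 1F b′))
      ≈⟨ *-congˡ (+-congˡ (trans (*-congˡ (-‿+-comm _ _)) (sym (-‿distribʳ-* h _)))) ⟩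
    dif (λ b → avg (λ a → f a b)) b ∎
    where b′ = opposite b

  -- The value is the same for both positions `p`: the two alternatives allowed at offsets 1 and 2
  -- have equal means.
  avg-δ : ∀ {f} p → (∀ a → f a ≈ I p a) → avg f ≈ h
  avg-δ 0F e = trans (*-congˡ (trans (+-cong (e 0F) (e 1F)) (+-identityʳ 1#))) (*-identityʳ h)
  avg-δ 1F e = trans (*-congˡ (trans (+-cong (e 0F) (e 1F)) (+-identityˡ 1#))) (*-identityʳ h)

  ⟦_⟧ : Bool → Carrier
  ⟦ b ⟧ = if b then 1# else 0#

  ⟦⟧-cong : ∀ {x y} → x ≡ y → ⟦ x ⟧ ≈ ⟦ y ⟧
  ⟦⟧-cong e = reflexive (≡.cong ⟦_⟧ e)

  I-sym : ∀ {n} (i j : Fin n) → I i j ≡ I j i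
  I-sym zero    zero    = ≡.refl
  I-sym zero    (suc j) = ≡.refl
  I-sym (suc i) zero    = ≡.refl
  I-sym (suc i) (suc j) = I-sym i j

  RealBlock : Set c
  RealBlock = Fin 2 → Row 2

  rowAvg colAvg : RealBlock → Row 2
  rowAvg X a = avg (X a)
  colAvg X b = avg (λ a → X a b)

  -- The entry at (i , a), (j , b) of Q M Qᵀ, where X, Y, Z and W are the
  -- blocks of M at (i, j), (i, j + 1), (i + 1, j) and (i + 1, j + 1).
  entry : (X Y Z W : RealBlock) → Fin 2 → Fin 2 → Carrier
  entry X Y Z W a b =
    avg (λ a′ → avg (X a′) + dif (Y a′) b) + dif (λ a′ → avg (Z a′) + dif (W a′) b) a

  avg-+ : ∀ f g → avg (λ a → f a + g a) ≈ avg f + avg g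
  avg-+ f g = begin
    avg (λ a → f a + g a)      ≈⟨ avg-cong (λ a → +-congʳ {g a} (*-identityˡ (f a))) ⟨
    avg (λ a → 1# * f a + g a) ≈⟨ avg-linear 1# f g ⟩
    1# * avg f + avg g         ≈⟨ +-congʳ (*-identityˡ _) ⟩
    avg f + avg g              ∎

  dif-+ : ∀ f g a → dif (λ a → f a + g a) a ≈ dif f a + dif g a
  dif-+ f g a = begin
    dif (λ a → f a + g a) a      ≈⟨ dif-cong (λ a → +-congʳ {g a} (*-identityˡ (f a))) a ⟨
    dif (λ a → 1# * f a + g a) a ≈⟨ dif-linear 1# f g a ⟩
    1# * dif f a + dif g a       ≈⟨ +-congʳ (*-identityˡ _) ⟩
    dif f a + dif g a            ∎

  -- Q keeps the mean at index i and takes the deviation from index i + 1, so by linearity each of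
  -- the four blocks contributes a single component: the mean of `X`, the column deviation of `Y`,
  -- the row deviation of `Z` and the double deviation of `W`.
  entry-sum : ∀ {X Y Z W a b x y z w} →
    avg (rowAvg X) ≈ x → dif (colAvg Y) b ≈ y → dif (rowAvg Z) a ≈ z → dif (λ a′ → dif (W a′) b) a ≈ w →
    entry X Y Z W a b ≈ (x + y) + (z + w)
  entry-sum {X} {Y} {Z} {W} {a} {b} ex ey ez ew = +-cong
    (trans (avg-+ (rowAvg X) (λ a′ → dif (Y a′) b)) (+-cong ex (trans (avg-dif Y b) ey)))
    (trans (dif-+ (rowAvg Z) (λ a′ → dif (W a′) b) a) (+-cong ez ew))

  ⟪_⟫ : Block → RealBlock
  ⟪ X ⟫ a b = ⟦ X a b ⟧

  rowAvg-row : ∀ {X} → IsRow X → ∀ a b → rowAvg ⟪ X ⟫ a ≈ ⟦ X a b ⟧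
  rowAvg-row r a b = avg-const λ b′ → ⟦⟧-cong (row⇒columnIndependent r a b′ b)

  colAvg-column : ∀ {X} → IsColumn X → ∀ a b → colAvg ⟪ X ⟫ b ≈ ⟦ X a b ⟧
  colAvg-column r a b = avg-const λ a′ → ⟦⟧-cong (column⇒rowIndependent r a′ a b)

  does-sym : ∀ {n} (a b : Fin n) → ⟦ does (a ≟ b) ⟧ ≈ I b a
  does-sym a b = reflexive (I-sym a b)

  avg-half : ∀ {X} → IsRow X ⊎ IsColumn X → avg (rowAvg ⟪ X ⟫) ≈ h
  avg-half (inj₁ r@(p , e)) = avg-δ p λ a →
    trans (rowAvg-row r a 0F) (trans (⟦⟧-cong (e a 0F)) (does-sym a p))
  avg-half (inj₂ (q , e)) = avg-const λ a → avg-δ q λ b → trans (⟦⟧-cong (e a b)) (does-sym b q)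

  dif-colAvg : ∀ {X} → ColumnIndependent X → ∀ b → dif (colAvg ⟪ X ⟫) b ≈ 0#
  dif-colAvg ci = dif-const λ b → avg-cong λ a → ⟦⟧-cong (ci a b 0F)

  dif-rowAvg : ∀ {X} → RowIndependent X → ∀ a → dif (rowAvg ⟪ X ⟫) a ≈ 0#
  dif-rowAvg ri = dif-const λ a → avg-cong λ b → ⟦⟧-cong (ri a 0F b)

  dif-dif : ∀ {X} → RowIndependent X ⊎ ColumnIndependent X → ∀ a b → dif (λ a′ → dif (⟪ X ⟫ a′) b) a ≈ 0#
  dif-dif (inj₁ ri) a b = dif-const (λ a′ → dif-cong (λ b → ⟦⟧-cong (ri a′ 0F b)) b) a
  dif-dif (inj₂ ci) a b = dif-const (λ a′ → dif-const (λ b → ⟦⟧-cong (ci a′ b 0F)) b) a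

  -- The term of `W` always vanishes. If `X` is constant, its mean is all that remains. Otherwise
  -- the mean of `X` is 1/2, which is also the mean of each row of `Y`, or of each column of `Z`;
  -- together with the one surviving deviation it restores that block.
  shape-entry : ∀ {X Y Z W R} → Shape X Y Z R → RowIndependent W ⊎ ColumnIndependent W →
                ∀ a b → ⟦ R a b ⟧ ≈ entry ⟪ X ⟫ ⟪ Y ⟫ ⟪ Z ⟫ ⟪ W ⟫ a b
  shape-entry {X} {Y} {Z} {W} {R} (new≡X ri ci ciY riZ R≡X) w a b = sym (begin
    entry ⟪ X ⟫ ⟪ Y ⟫ ⟪ Z ⟫ ⟪ W ⟫ a b
      ≈⟨ entry-sum {⟪ X ⟫} {⟪ Y ⟫} {⟪ Z ⟫} {⟪ W ⟫}
           (avg-const λ a′ → avg-const λ b′ → ⟦⟧-cong (≡.trans (ri a′ a b′) (ci a b′ b)))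
           (dif-colAvg ciY b) (dif-rowAvg riZ a) (dif-dif w a b) ⟩
    ⟦ X a b ⟧ + 0# + (0# + 0#)
      ≈⟨ trans (+-cong (+-identityʳ _) (+-identityʳ 0#)) (+-identityʳ _) ⟩
    ⟦ X a b ⟧
      ≈⟨ ⟦⟧-cong (R≡X a b) ⟨
    ⟦ R a b ⟧ ∎)
  shape-entry {X} {Y} {Z} {W} {R} (new≡Y half cY riZ R≡Y) w a b = sym (begin
    entry ⟪ X ⟫ ⟪ Y ⟫ ⟪ Z ⟫ ⟪ W ⟫ a b
      ≈⟨ entry-sum {⟪ X ⟫} {⟪ Y ⟫} {⟪ Z ⟫} {⟪ W ⟫}
           (avg-half half) (dif-cong (colAvg-column cY a) b) (dif-rowAvg riZ a) (dif-dif w a b) ⟩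
    h + dif (⟪ Y ⟫ a) b + (0# + 0#)
      ≈⟨ trans (+-congˡ (+-identityʳ 0#)) (+-identityʳ _) ⟩
    h + dif (⟪ Y ⟫ a) b
      ≈⟨ +-congʳ (avg-δ (proj₁ cY) λ b → trans (⟦⟧-cong (proj₂ cY a b)) (does-sym b _)) ⟨
    avg (⟪ Y ⟫ a) + dif (⟪ Y ⟫ a) b
      ≈⟨ avg+dif (⟪ Y ⟫ a) b ⟩
    ⟦ Y a b ⟧
      ≈⟨ ⟦⟧-cong (R≡Y a b) ⟨
    ⟦ R a b ⟧ ∎)
  shape-entry {X} {Y} {Z} {W} {R} (new≡Z half ciY rZ R≡Z) w a b = sym (begin
    entry ⟪ X ⟫ ⟪ Y ⟫ ⟪ Z ⟫ ⟪ W ⟫ a b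
      ≈⟨ entry-sum {⟪ X ⟫} {⟪ Y ⟫} {⟪ Z ⟫} {⟪ W ⟫}
           (avg-half half) (dif-colAvg ciY b) (dif-cong (λ a → rowAvg-row rZ a b) a) (dif-dif w a b) ⟩
    h + 0# + (dif (λ a → ⟪ Z ⟫ a b) a + 0#)
      ≈⟨ +-cong (+-identityʳ h) (+-identityʳ _) ⟩
    h + dif (λ a → ⟪ Z ⟫ a b) a
      ≈⟨ +-congʳ (avg-δ (proj₁ rZ) λ a → trans (⟦⟧-cong (proj₂ rZ a b)) (does-sym a _)) ⟨
    avg (λ a → ⟪ Z ⟫ a b) + dif (λ a → ⟪ Z ⟫ a b) a
      ≈⟨ avg+dif (λ a → ⟪ Z ⟫ a b) a ⟩
    ⟦ Z a b ⟧
      ≈⟨ ⟦⟧-cong (R≡Z a b) ⟨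
    ⟦ R a b ⟧ ∎)

  -- The matrix Q and the switched graph.

  module _ {n m : ℕ} (m≥5 : m ≥ 5) (Γ : Graph n) (P : Partition n m) (S : Switchable Γ P) where
    open Graph Γ using (adj; symm)
    open Partition P
    open Blocks m≥5 Γ P S

    Label : Set
    Label = (Fin m × Fin 2) ⊎ Fin d

    -- The row of Q at the given label, as a linear functional.
    E : Label → Row n → Carrier
    E (inj₁ (i , a)) f = avg (f ∘ v i) + dif (f ∘ v (i ⊕ 1)) a
    E (inj₂ y)       f = f (D y)

    E-cong : ∀ ℓ {f g} → f ≋ g → E ℓ f ≈ E ℓ g
    E-cong (inj₁ (i , a)) e = +-cong (avg-cong (e ∘ v i)) (dif-cong (e ∘ v (i ⊕ 1)) a)
    E-cong (inj₂ y)       e = e (D y)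

    E-linear : ∀ ℓ x f g → E ℓ (λ z → x * f z + g z) ≈ x * E ℓ f + E ℓ g
    E-linear (inj₁ (i , a)) x f g = trans
      (+-cong (avg-linear x (f ∘ v i) (g ∘ v i)) (dif-linear x (f ∘ v (i ⊕ 1)) (g ∘ v (i ⊕ 1)) a))
      (solve 5 (λ x p q r s → (x :* p :+ q) :+ (x :* r :+ s) := x :* (p :+ r) :+ (q :+ s))
        refl x _ _ _ _)
    E-linear (inj₂ y)       x f g = refl

    E-const : ∀ ℓ x → E ℓ (λ _ → x) ≈ x
    E-const (inj₁ (i , a)) x =
      trans (+-cong (avg-const λ _ → refl) (dif-const (λ _ → refl) a)) (+-identityʳ x)
    E-const (inj₂ y)       x = refl

    E-zero : ∀ i a f → (∀ j b → f (v j b) ≈ 0#) → E (inj₁ (i , a)) f ≈ 0#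
    E-zero i a f e = trans (+-cong (avg-const (e i)) (dif-const (e (i ⊕ 1)) a)) (+-identityʳ 0#)

    E-sum : ∀ {p} ℓ (g : Fin n → Row p) (x : Row p) →
      sum (λ k → E ℓ (λ z → g z k) * x k) ≈ E ℓ (λ z → sum (λ k → g z k * x k))
    E-sum {ℕ.zero}  ℓ g x = sym (E-const ℓ 0#)
    E-sum {ℕ.suc p} ℓ g x = begin
      E ℓ (λ z → g z zero) * x zero + sum (λ k → E ℓ (λ z → g z (suc k)) * x (suc k))
        ≈⟨ +-cong (*-comm _ _) (E-sum ℓ (λ z → g z ∘ suc) (x ∘ suc)) ⟩
      x zero * E ℓ (λ z → g z zero) + E ℓ (λ z → sum (λ k → g z (suc k) * x (suc k)))
        ≈⟨ E-linear ℓ (x zero) (λ z → g z zero) (λ z → sum (λ k → g z (suc k) * x (suc k))) ⟨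
      E ℓ (λ z → x zero * g z zero + sum (λ k → g z (suc k) * x (suc k)))
        ≈⟨ E-cong ℓ (λ z → +-congʳ (*-comm _ _)) ⟩
      E ℓ (λ z → sum (λ k → g z k * x k)) ∎

    -- The entries of Q M Qᵀ, written with functionals in place of sums over all vertices. At two
    -- labels from the sets Cᵢ this unfolds to `entry` of four blocks of `M`.
    conjugate : Matrix n → Label → Label → Carrier
    conjugate M ℓ ℓ′ = E ℓ (λ z → E ℓ′ (M z))

    Q Qᵀ : Matrix n
    Q x z  = E (label x) (λ w → I w z)
    Qᵀ z x = Q x z

    Q-row : ∀ x (u : Row n) → sum (λ k → Q x k * u k) ≈ E (label x) u
    Q-row x u = trans (E-sum (label x) I u) (E-cong (label x) λ z → functional-I z u)

    Q-conjugate : ∀ M x y → (Q · (M · Qᵀ)) x y ≈ conjugate M (label x) (label y)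
    Q-conjugate M x y = trans (Q-row x (λ z → (M · Qᵀ) z y)) (E-cong (label x) λ z →
      trans (sum-cong-≋ λ k → *-comm (M z k) (Q y k)) (Q-row y (M z)))

    vertex-label : ∀ x → vertex (label x) ≡ x
    vertex-label = Inverse.strictlyInverseʳ labelling

    vertex-injective : ∀ {ℓ ℓ′} → vertex ℓ ≡ vertex ℓ′ → ℓ ≡ ℓ′
    vertex-injective {ℓ} {ℓ′} e = ≡.trans (≡.sym (Inverse.strictlyInverseˡ labelling ℓ))
      (≡.trans (≡.cong label e) (Inverse.strictlyInverseˡ labelling ℓ′))

    I-vertex-off : ∀ ℓ ℓ′ → ℓ ≢ ℓ′ → I (vertex ℓ) (vertex ℓ′) ≈ 0#
    I-vertex-off ℓ ℓ′ ℓ≢ℓ′ = reflexive (I-off (ℓ≢ℓ′ ∘ vertex-injective))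

    I-v : ∀ i a b → I (v i a) (v i b) ≈ I a b
    I-v i a b with a ≟ b
    ... | yes ≡.refl = reflexive (I-diag (v i a))
    ... | no a≢b     = reflexive (I-off (a≢b ∘ proj₂ ∘ v-injective))

    I-v-off : ∀ {i j} → i ≢ j → ∀ a b → I (v i a) (v j b) ≈ 0#
    I-v-off i≢j a b = reflexive (I-off (i≢j ∘ proj₁ ∘ v-injective))

    rowAvg-I : ∀ i a → avg (λ b → I (v i a) (v i b)) ≈ h
    rowAvg-I i a = avg-δ a (I-v i a)

    colAvg-I : ∀ i b → avg (λ a → I (v i a) (v i b)) ≈ h
    colAvg-I i b = avg-δ b λ a → trans (I-v i a b) (reflexive (I-sym a b))

    IBlk : Fin m → Fin m → RealBlock
    IBlk i j a b = I (v i a) (v j b)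

    dif-colAvg-I : ∀ i j b → dif (colAvg (IBlk i j)) b ≈ 0#
    dif-colAvg-I i j b with i ≟ j
    ... | yes ≡.refl = dif-const (colAvg-I i) b
    ... | no i≢j     = dif-const (λ b → avg-const λ a → I-v-off i≢j a b) b

    dif-rowAvg-I : ∀ i j a → dif (rowAvg (IBlk i j)) a ≈ 0#
    dif-rowAvg-I i j a with i ≟ j
    ... | yes ≡.refl = dif-const (rowAvg-I i) a
    ... | no i≢j     = dif-const (λ a → avg-const λ b → I-v-off i≢j a b) a

    -- This is Q Qᵀ = I. For `i = j` the double deviation survives, as the 2 × 2 identity depends on
    -- both indices: it is the identity block at i + 1 less its mean 1/2, and the block at i
    -- supplies that mean.
    conjugate-I : ∀ ℓ ℓ′ → I (vertex ℓ) (vertex ℓ′) ≈ conjugate I ℓ ℓ′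
    conjugate-I (inj₁ (i , a)) (inj₁ (j , b)) with i ≟ j
    ... | yes ≡.refl = sym (begin
      entry (IBlk i i) (IBlk i i⁺) (IBlk i⁺ i) (IBlk i⁺ i⁺) a b
        ≈⟨ entry-sum {IBlk i i} {IBlk i i⁺} {IBlk i⁺ i} {IBlk i⁺ i⁺}
             (avg-const (rowAvg-I i)) (dif-colAvg-I i i⁺ b) (dif-rowAvg-I i⁺ i a) refl ⟩
      h + 0# + (0# + dif g a)
        -- The zero is read as the mean of `g`, so that mean and deviation recombine to `g a`.
        ≈⟨ +-congˡ (+-congʳ gAvg) ⟨
      h + 0# + (avg g + dif g a)
        ≈⟨ +-cong (+-identityʳ h) (avg+dif g a) ⟩
      h + g a
        ≈⟨ +-congʳ (rowAvg-I i⁺ a) ⟨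
      avg (IBlk i⁺ i⁺ a) + dif (IBlk i⁺ i⁺ a) b
        ≈⟨ avg+dif (IBlk i⁺ i⁺ a) b ⟩
      I (v i⁺ a) (v i⁺ b)
        ≈⟨ trans (I-v i⁺ a b) (sym (I-v i a b)) ⟩
      I (v i a) (v i b) ∎)
      where
      i⁺ = i ⊕ 1
      g : Row 2
      g a = dif (IBlk i⁺ i⁺ a) b
      gAvg : avg g ≈ 0#
      gAvg = trans (avg-dif (IBlk i⁺ i⁺) b) (dif-colAvg-I i⁺ i⁺ b)
    ... | no i≢j = trans (I-v-off i≢j a b) (sym (begin
      entry (IBlk i j) (IBlk i j⁺) (IBlk i⁺ j) (IBlk i⁺ j⁺) a b
        ≈⟨ entry-sum {IBlk i j} {IBlk i j⁺} {IBlk i⁺ j} {IBlk i⁺ j⁺}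
             (avg-const λ a → avg-const (I-v-off i≢j a)) (dif-colAvg-I i j⁺ b) (dif-rowAvg-I i⁺ j a)
             (dif-const (λ a → dif-const (I-v-off (i≢j ∘ ⊕1-injective) a) b) a) ⟩
      0# + 0# + (0# + 0#)
        ≈⟨ trans (+-cong (+-identityʳ 0#) (+-identityʳ 0#)) (+-identityʳ 0#) ⟩
      0# ∎))
      where
      i⁺ = i ⊕ 1
      j⁺ = j ⊕ 1
    conjugate-I (inj₁ (i , a)) (inj₂ y) = trans (I-vertex-off (inj₁ (i , a)) (inj₂ y) λ ())
      (sym (E-zero i a (λ z → I z (D y)) λ j b → I-vertex-off (inj₁ (j , b)) (inj₂ y) λ ()))
    conjugate-I (inj₂ x) (inj₁ (j , b)) = trans (I-vertex-off (inj₂ x) (inj₁ (j , b)) λ ())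
      (sym (E-zero j b (I (D x)) λ i a → I-vertex-off (inj₂ x) (inj₁ (i , a)) λ ()))
    conjugate-I (inj₂ x) (inj₂ y) = refl

    A : Matrix n
    A = adjacencyMatrix Γ

    -- If the row is constant on each set, its deviations vanish and the means are the old entries.
    -- If it has one neighbour in each set, all its means are 1/2, so shifting the deviations alone
    -- shifts the whole row.
    D-entry : ∀ x i a → ⟦ switchD Γ P x i a ⟧ ≈ E (inj₁ (i , a)) (A (D x))
    D-entry x i a with D-shape x
    ... | inj₁ (e , s) = sym (trans
      (+-cong (avg-const λ b → ⟦⟧-cong (const i b a)) (dif-const (λ b → ⟦⟧-cong (const (i ⊕ 1) b 0F)) a))
      (trans (+-identityʳ _) (⟦⟧-cong (≡.sym (s i a)))))
      where
      const : ∀ j b b′ → adj (D x) (v j b) ≡ adj (D x) (v j b′)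
      const j 0F 0F = ≡.refl
      const j 0F 1F = e j
      const j 1F 0F = ≡.sym (e j)
      const j 1F 1F = ≡.refl
    ... | inj₂ (e , s) = sym (begin
      avg (f i) + dif (f (i ⊕ 1)) a       ≈⟨ +-congʳ (trans (fAvg i) (sym (fAvg (i ⊕ 1)))) ⟩
      avg (f (i ⊕ 1)) + dif (f (i ⊕ 1)) a ≈⟨ avg+dif (f (i ⊕ 1)) a ⟩
      f (i ⊕ 1) a                         ≈⟨ ⟦⟧-cong (s i a) ⟨
      ⟦ switchD Γ P x i a ⟧               ∎)
      where
      f : Fin m → Row 2
      f j b = A (D x) (v j b)
      fAvg : ∀ j → avg (f j) ≈ h
      fAvg j = avg-δ (proj₁ (e j)) λ b → trans (⟦⟧-cong (proj₂ (e j) b)) (does-sym b _)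

    conjugate-A : ∀ ℓ ℓ′ → ⟦ switchAdj Γ P ℓ ℓ′ ⟧ ≈ conjugate A ℓ ℓ′
    conjugate-A (inj₁ (i , a)) (inj₁ (j , b)) = shape-entry (shape i j) (independent (i ⊕ 1) (j ⊕ 1)) a b
    conjugate-A (inj₁ (i , a)) (inj₂ y) =
      trans (D-entry y i a) (E-cong (inj₁ (i , a)) λ z → ⟦⟧-cong (symm (D y) z))
    conjugate-A (inj₂ x) (inj₁ (j , b)) = D-entry x j b
    conjugate-A (inj₂ x) (inj₂ y) = refl

    A′ : Matrix n
    A′ = adjacencyMatrix (switch Γ P m≥5)

    det-conjugate : ∀ {M M′} → (∀ x y → M′ x y ≈ conjugate M (label x) (label y)) →
                    det M′ ≈ det Q * det Qᵀ * det M
    det-conjugate {M} {M′} e = begin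
      det M′                    ≈⟨ det-cong (λ x y → trans (e x y) (sym (Q-conjugate M x y))) ⟩
      det (Q · (M · Qᵀ))        ≈⟨ det-· Q (M · Qᵀ) ⟩
      det Q * det (M · Qᵀ)      ≈⟨ *-congˡ (det-· M Qᵀ) ⟩
      det Q * (det M * det Qᵀ)  ≈⟨ solve 3 (λ q m r → q :* (m :* r) := q :* r :* m) refl (det Q) (det M) (det Qᵀ) ⟩
      det Q * det Qᵀ * det M    ∎

    label-conjugate-I : ∀ x y → I x y ≈ conjugate I (label x) (label y)
    label-conjugate-I x y = trans
      (reflexive (≡.cong₂ I (≡.sym (vertex-label x)) (≡.sym (vertex-label y))))
      (conjugate-I (label x) (label y))

    -- Conjugation by Q maps `I` to itself, so `det-conjugate` can be read with `I` on both sides.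
    det-Q : det Q * det Qᵀ ≈ 1#
    det-Q = begin
      det Q * det Qᵀ               ≈⟨ *-identityʳ _ ⟨
      det Q * det Qᵀ * 1#          ≈⟨ *-congˡ (det-I n) ⟨
      det Q * det Qᵀ * det (I {n}) ≈⟨ det-conjugate label-conjugate-I ⟨
      det (I {n})                  ≈⟨ det-I n ⟩
      1#                           ∎

    conjugate-linear : ∀ x M N ℓ ℓ′ →
      conjugate (λ z w → x * M z w + N z w) ℓ ℓ′ ≈ x * conjugate M ℓ ℓ′ + conjugate N ℓ ℓ′
    conjugate-linear x M N ℓ ℓ′ = trans (E-cong ℓ λ z → E-linear ℓ′ x (M z) (N z))
      (E-linear ℓ x (λ z → E ℓ′ (M z)) (λ z → E ℓ′ (N z)))

    conjugate-cong : ∀ {M N} → (∀ z → M z ≋ N z) → ∀ ℓ ℓ′ → conjugate M ℓ ℓ′ ≈ conjugate N ℓ ℓ′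
    conjugate-cong e ℓ ℓ′ = E-cong ℓ λ z → E-cong ℓ′ (e z)

    charPoly-switch : ∀ r x →
      charPoly (λ z w → A′ z w + r * J z w) x ≈ charPoly (λ z w → A z w + r * J z w) x
    charPoly-switch r x = trans (det-conjugate {N A} {N A′} N-conjugate)
      (trans (*-congʳ det-Q) (*-identityˡ _))
      where
      N : Matrix n → Matrix n
      N M z w = x * I z w - (M z w + r * 1#)
      -- Brings the matrix into the form `a * _ + _` required by `conjugate-linear`, with the
      -- multiple of J as a constant, which `E-const` shows to be fixed.
      N-expand : ∀ M z w → N M z w ≈ x * I z w + (- 1# * M z w + - (r * 1#))
      N-expand M z w = +-congˡ (trans (sym (-‿+-comm _ _)) (+-congʳ (sym (-1*x≈-x _))))
      N-conjugate : ∀ z w → N A′ z w ≈ conjugate (N A) (label z) (label w)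
      N-conjugate z w = begin
        N A′ z w
          ≈⟨ N-expand A′ z w ⟩
        x * I z w + (- 1# * A′ z w + - (r * 1#))
          ≈⟨ +-cong (*-congˡ (label-conjugate-I z w)) (+-cong (*-congˡ (conjugate-A ℓ ℓ′))
               (sym (trans (E-cong ℓ λ _ → E-const ℓ′ _) (E-const ℓ _)))) ⟩
        x * conjugate I ℓ ℓ′ + (- 1# * conjugate A ℓ ℓ′ + conjugate (λ _ _ → - (r * 1#)) ℓ ℓ′)
          ≈⟨ +-congˡ (conjugate-linear (- 1#) A (λ _ _ → - (r * 1#)) ℓ ℓ′) ⟨
        x * conjugate I ℓ ℓ′ + conjugate (λ z w → - 1# * A z w + - (r * 1#)) ℓ ℓ′
          ≈⟨ conjugate-linear x I (λ z w → - 1# * A z w + - (r * 1#)) ℓ ℓ′ ⟨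
        conjugate (λ z w → x * I z w + (- 1# * A z w + - (r * 1#))) ℓ ℓ′
          ≈⟨ conjugate-cong (N-expand A) ℓ ℓ′ ⟨
        conjugate (N A) ℓ ℓ′ ∎
        where
        ℓ = label z
        ℓ′ = label w

    cospectral : Cospectral Γ (switch Γ P m≥5)
    cospectral r μ k = mk⇔
      -- The characteristic polynomials agree at every `x`, so the cofactor `q` carries over
      -- unchanged.
      (λ (q , e , q#0) → q , (λ x → trans (charPoly-switch r x) (e x)) , q#0)
      (λ (q , e , q#0) → q , (λ x → trans (sym (charPoly-switch r x)) (e x)) , q#0)

theorem8 : ∀ {c ℓ₁ ℓ₂} (ℝ : RealField c ℓ₁ ℓ₂) {n m : ℕ} (m≥5 : m ≥ 5)
    (Γ : Graph n) (P : Partition n m) → Switchable Γ P →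
    Spectrum.Cospectral ℝ Γ (switch Γ P m≥5)
theorem8 ℝ m≥5 Γ P S = Conjugation.cospectral ℝ m≥5 Γ P S
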